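{- There exist natural numbers $l,m,n$ such that the following set is undecidable: the set of prenex sentences in the first-order language with binary relation symbol $\sim$ and equality whose quantifier prefix has the form $\exists^j\forall^l\exists^m\forall^n$ for some $j\ge0$ (i.e. $j$ existential quantifiers, then $l$ universal, then $m$ existential, then $n$ universal) and which are true on some finite graph.
   Context: A graph is a structure for this language in which $\sim$ is interpreted by an irreflexive symmetric relation. -}

module Defs where

open import Data.Bool using (Bool; T)
open import Data.Empty using (⊥-elim)
open import Data.Fin using (Fin; toℕ)
open import Data.Fin.Properties using (toℕ-injective)
open import Data.Nat using (ℕ; zero; suc; _+_; _*_; _^_; _<_)
open import Data.Nat.Properties using (*-identityˡ; *-assoc; *-cancelˡ-≡; even≢odd; suc-injective)
open import Data.Product using (Σ; ∃; ∃-syntax; _×_; _,_; proj₁; proj₂)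
open import Data.Sum using (_⊎_)
open import Data.Vec using (Vec; []; _∷_; lookup)
open import Data.Vec.Relation.Binary.Pointwise.Inductive using (Pointwise)
open import Relation.Binary.Definitions using (Symmetric; Irreflexive)
open import Relation.Binary.PropositionalEquality
  using (_≡_; refl; sym; trans; cong; cong₂)
open import Relation.Nullary using (¬_)
open import Relation.Unary using (Pred)
open import Level using (0ℓ)

-- Formula k: free variables among k, as de Bruijn indices (index 0 is the
-- innermost bound variable).
data Formula (k : ℕ) : Set where
  _≐_ _∼_         : Fin k → Fin k → Formula k
  ¬′_              : Formula k → Formula k
  _∧_ _∨_ _⇒_     : Formula k → Formula k → Formula k
  all ex          : Formula (suc k) → Formula k

Sentence : Set
Sentence = Formula 0

data QuantifierFree {k : ℕ} : Formula k → Set where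
  _≐_ : ∀ x y → QuantifierFree (x ≐ y)
  _∼_ : ∀ x y → QuantifierFree (x ∼ y)
  ¬′_  : ∀ {φ} → QuantifierFree φ → QuantifierFree (¬′ φ)
  _∧_ : ∀ {φ ψ} → QuantifierFree φ → QuantifierFree ψ → QuantifierFree (φ ∧ ψ)
  _∨_ : ∀ {φ ψ} → QuantifierFree φ → QuantifierFree ψ → QuantifierFree (φ ∨ ψ)
  _⇒_ : ∀ {φ ψ} → QuantifierFree φ → QuantifierFree ψ → QuantifierFree (φ ⇒ ψ)

all^ ex^ : ∀ i {k} → Formula (i + k) → Formula k
all^ zero    φ = φ
all^ (suc i) φ = all^ i (all φ)
ex^ zero    φ = φ
ex^ (suc i) φ = ex^ i (ex φ)

Prenex-∃*∀∃∀ : (l m n : ℕ) → Pred Sentence 0ℓ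
Prenex-∃*∀∃∀ l m n φ =
  ∃[ j ] Σ (Formula (n + (m + (l + (j + 0))))) λ ψ →
    QuantifierFree ψ × φ ≡ ex^ j (all^ l (ex^ m (all^ n ψ)))

-- As usual for first-order structures, the domain is nonempty.  A finite
-- structure may be taken to live on an initial segment of ℕ; adjacency is
-- Boolean-valued so that truth in a finite graph is decidable, and hence the
-- type-theoretic reading of the connectives below is the classical one.
record FiniteGraph : Set where
  field
    size-1 : ℕ

  Vertex : Set
  Vertex = Fin (suc size-1)

  field
    adjacent : Vertex → Vertex → Bool

  Adj : Vertex → Vertex → Set
  Adj u v = T (adjacent u v)

  field
    symmetric   : Symmetric Adj
    irreflexive : Irreflexive _≡_ Adj

module _ (G : FiniteGraph) where
  open FiniteGraph G

  Holds : ∀ {k} → Formula k → Vec Vertex k → Set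
  Holds (x ≐ y) ρ = lookup ρ x ≡ lookup ρ y
  Holds (x ∼ y) ρ = Adj (lookup ρ x) (lookup ρ y)
  Holds (¬′ φ)   ρ = ¬ Holds φ ρ
  Holds (φ ∧ ψ) ρ = Holds φ ρ × Holds ψ ρ
  Holds (φ ∨ ψ) ρ = Holds φ ρ ⊎ Holds ψ ρ
  Holds (φ ⇒ ψ) ρ = Holds φ ρ → Holds ψ ρ
  Holds (all φ) ρ = (v : Vertex) → Holds φ (v ∷ ρ)
  Holds (ex φ)  ρ = Σ Vertex λ v → Holds φ (v ∷ ρ)

_⊨_ : FiniteGraph → Sentence → Set
G ⊨ φ = Holds G φ []

TrueOnSomeFiniteGraph : Pred Sentence 0ℓ
TrueOnSomeFiniteGraph φ = Σ FiniteGraph λ G → G ⊨ φ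

data Rec : ℕ → Set where
  zer  : Rec 0
  succ : Rec 1
  proj : ∀ {k} → Fin k → Rec k
  comp : ∀ {k i} → Rec i → Vec (Rec k) i → Rec k
  prec : ∀ {k} → Rec k → Rec (suc (suc k)) → Rec (suc k)
  mu   : ∀ {k} → Rec (suc k) → Rec k

-- f [ xs ]⇓ y: the partial function f is defined at xs, with value y.
data _[_]⇓_ : ∀ {k} → Rec k → Vec ℕ k → ℕ → Set where
  zer⇓   : zer [ [] ]⇓ 0
  succ⇓  : ∀ {x} → succ [ x ∷ [] ]⇓ suc x
  proj⇓  : ∀ {k} {xs : Vec ℕ k} (i : Fin k) → proj i [ xs ]⇓ lookup xs i
  comp⇓  : ∀ {k i} {f : Rec i} {gs : Vec (Rec k) i} {xs ys z} →
           Pointwise (λ g y → g [ xs ]⇓ y) gs ys → f [ ys ]⇓ z →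
           comp f gs [ xs ]⇓ z
  prec⇓0 : ∀ {k} {f : Rec k} {g xs z} →
           f [ xs ]⇓ z → prec f g [ 0 ∷ xs ]⇓ z
  prec⇓s : ∀ {k} {f : Rec k} {g xs n y z} →
           prec f g [ n ∷ xs ]⇓ y → g [ n ∷ y ∷ xs ]⇓ z →
           prec f g [ suc n ∷ xs ]⇓ z
  mu⇓    : ∀ {k} {f : Rec (suc k)} {xs y} →
           f [ y ∷ xs ]⇓ 0 → (∀ z → z < y → ∃[ w ] f [ z ∷ xs ]⇓ suc w) →
           mu f [ xs ]⇓ y

-- e computes the characteristic function of A.  Constructively this asks no
-- more of e than requiring it to be total with the right values, and
-- classically it asks the same.
ComputesCharacteristic : Rec 1 → Pred ℕ 0ℓ → Set
ComputesCharacteristic e A =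
  ∀ x → (A x → e [ x ∷ [] ]⇓ 1) × (¬ A x → e [ x ∷ [] ]⇓ 0)

Recursive : Pred ℕ 0ℓ → Set
Recursive A = ∃[ e ] ComputesCharacteristic e A

-- Every positive integer is uniquely a power of 2 times an odd number.
pair : ℕ → ℕ → ℕ
pair a b = 2 ^ a * suc (2 * b)

code : ∀ {k} → Formula k → ℕ
code (x ≐ y) = pair 0 (pair (toℕ x) (toℕ y))
code (x ∼ y) = pair 1 (pair (toℕ x) (toℕ y))
code (¬′ φ)   = pair 2 (code φ)
code (φ ∧ ψ) = pair 3 (pair (code φ) (code ψ))
code (φ ∨ ψ) = pair 4 (pair (code φ) (code ψ))
code (φ ⇒ ψ) = pair 5 (pair (code φ) (code ψ))
code (all φ) = pair 6 (code φ)
code (ex φ)  = pair 7 (code φ)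

Decidable : Pred Sentence 0ℓ → Set
Decidable S = Recursive (λ x → ∃[ φ ] S φ × code φ ≡ x)

Undecidable : Pred Sentence 0ℓ → Set
Undecidable S = ¬ Decidable S

pair-injective : ∀ a b {c d} → pair a b ≡ pair c d → a ≡ c × b ≡ d
pair-injective zero b {zero} {d} p =
  refl , *-cancelˡ-≡ b d 2
    (suc-injective (trans (sym (*-identityˡ _)) (trans p (*-identityˡ _))))
pair-injective zero b {suc c} {d} p =
  ⊥-elim (even≢odd (pair c d) b
    (trans (sym (*-assoc 2 (2 ^ c) _)) (trans (sym p) (*-identityˡ _))))
pair-injective (suc a) b {zero} {d} p =
  ⊥-elim (even≢odd (pair a b) d
    (trans (sym (*-assoc 2 (2 ^ a) _)) (trans p (*-identityˡ _))))
pair-injective (suc a) b {suc c} {d} p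
  with pair-injective a b {c} {d}
         (*-cancelˡ-≡ (pair a b) (pair c d) 2
           (trans (sym (*-assoc 2 (2 ^ a) _)) (trans p (*-assoc 2 (2 ^ c) _))))
... | a≡c , b≡d = cong suc a≡c , b≡d

private
  tag body : ∀ {k} → Formula k → ℕ
  tag (_ ≐ _) = 0
  tag (_ ∼ _) = 1
  tag (¬′ _) = 2
  tag (_ ∧ _) = 3
  tag (_ ∨ _) = 4
  tag (_ ⇒ _) = 5
  tag (all _) = 6
  tag (ex _) = 7
  body (a ≐ b) = pair (toℕ a) (toℕ b)
  body (a ∼ b) = pair (toℕ a) (toℕ b)
  body (¬′ a) = code a
  body (a ∧ b) = pair (code a) (code b)
  body (a ∨ b) = pair (code a) (code b)
  body (a ⇒ b) = pair (code a) (code b)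
  body (all a) = code a
  body (ex a) = code a

  code-split : ∀ {k} (φ : Formula k) → code φ ≡ pair (tag φ) (body φ)
  code-split (_ ≐ _) = refl
  code-split (_ ∼ _) = refl
  code-split (¬′ _) = refl
  code-split (_ ∧ _) = refl
  code-split (_ ∨ _) = refl
  code-split (_ ⇒ _) = refl
  code-split (all _) = refl
  code-split (ex _) = refl

  split : ∀ {k} (φ ψ : Formula k) → code φ ≡ code ψ → tag φ ≡ tag ψ × body φ ≡ body ψ
  split φ ψ p = pair-injective (tag φ) (body φ)
    (trans (sym (code-split φ)) (trans p (code-split ψ)))

mutual
  code-injective : ∀ {k} (φ ψ : Formula k) → code φ ≡ code ψ → φ ≡ ψ
  code-injective φ ψ p = step φ ψ (proj₁ (split φ ψ p)) (proj₂ (split φ ψ p))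

  private
    step : ∀ {k} (φ ψ : Formula k) → tag φ ≡ tag ψ → body φ ≡ body ψ → φ ≡ ψ
    step (a ≐ b) (c ≐ d) _ q = let r = pair-injective (toℕ a) (toℕ b) q in
      cong₂ _≐_ (toℕ-injective (proj₁ r)) (toℕ-injective (proj₂ r))
    step (a ∼ b) (c ∼ d) _ q = let r = pair-injective (toℕ a) (toℕ b) q in
      cong₂ _∼_ (toℕ-injective (proj₁ r)) (toℕ-injective (proj₂ r))
    step (¬′ a) (¬′ c) _ q = cong ¬′_ (code-injective a c q)
    step (a ∧ b) (c ∧ d) _ q = let r = pair-injective (code a) (code b) q in
      cong₂ _∧_ (code-injective a c (proj₁ r)) (code-injective b d (proj₂ r))
    step (a ∨ b) (c ∨ d) _ q = let r = pair-injective (code a) (code b) q in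
      cong₂ _∨_ (code-injective a c (proj₁ r)) (code-injective b d (proj₂ r))
    step (a ⇒ b) (c ⇒ d) _ q = let r = pair-injective (code a) (code b) q in
      cong₂ _⇒_ (code-injective a c (proj₁ r)) (code-injective b d (proj₂ r))
    step (all a) (all c) _ q = cong all (code-injective a c q)
    step (ex a) (ex c) _ q = cong ex (code-injective a c q)

{-# OPTIONS --safe #-}
module Submission where

-- Suppose that e decides the set. Computations of a program f are described by
-- Horn rules, a few for each subprogram of f, about records K ⟨ a , b , c ⟩ that
-- relate values (numbers and lists). A rule speaks about boundedly many values
-- and records, so after coding records and values by vertices of a graph the
-- rules of any f become a matrix under one fixed prefix ∀³⁰∃²⁵; the labels K,
-- of which there are as many as f needs, and the numerals up to an input x are
-- named by the leading existential quantifiers. In a graph satisfying the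
-- sentence for "f halts on x with value 0" every recorded output of f is
-- correct, so f cannot have another value at x; conversely a halting
-- computation yields a finite graph. Since the matrix M of the rules of f does
-- not mention x, the code of the sentence for f and x = code M is a computable
-- function of x. Taking for f the composition of e with this function makes e
-- err on that sentence.

open import Data.Bool using (Bool; false; T)
open import Data.Bool.Properties using (T?)
open import Data.Empty using (⊥; ⊥-elim)
open import Data.Fin using (Fin; zero; suc; toℕ; combine; remQuot; _↑ˡ_; _↑ʳ_)
open import Data.Fin.Patterns
open import Data.Fin.Properties
  using (toℕ-combine; toℕ-↑ˡ; toℕ-↑ʳ; remQuot-combine; toℕ≤pred[n])
open import Data.List using (List; []; _∷_; length; upTo; allFin; cartesianProductWith)
  renaming (_++_ to _++ᴸ_; lookup to lookupᴸ; map to mapᴸ)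
open import Data.List.Membership.Propositional using (_∈_)
open import Data.List.Membership.Propositional.Properties
  using (∈-++⁺ˡ; ∈-++⁺ʳ; ∈-++⁻; ∈-map⁺; ∈-map⁻; ∈-lookup; ∈-upTo⁺; ∈-allFin;
         ∈-cartesianProductWith⁺; ∈-cartesianProductWith⁻)
open import Data.List.Relation.Unary.All using ([]; _∷_; universal) renaming (All to Allᴸ)
import Data.List.Relation.Unary.All.Properties as Allᴸₚ
open import Data.List.Relation.Unary.Any using (here; there; index)
open import Data.List.Relation.Unary.Any.Properties using (lookup-index)
open import Data.Nat
  using (ℕ; zero; suc; _+_; _*_; _^_; _⊓_; _≤_; _<_; z≤n; s≤s; _≡ᵇ_; _≤ᵇ_)
open import Data.Nat.GeneralisedArithmetic using (fold)
open import Data.Nat.Properties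
open import Data.Product using (Σ; ∃-syntax; _×_; _,_; proj₁; proj₂; uncurry)
open import Data.Sum using (_⊎_; inj₁; inj₂; [_,_])
open import Data.Unit using (⊤; tt)
open import Data.Vec using (Vec; []; _∷_; lookup; tabulate; _++_)
open import Data.Vec.Properties using (lookup-++ˡ; lookup-++ʳ; lookup∘tabulate)
open import Data.Vec.Relation.Binary.Pointwise.Inductive using (Pointwise; []; _∷_)
open import Data.Vec.Relation.Unary.All using (All; []; _∷_)
import Data.Vec.Relation.Unary.All as All
import Data.Vec.Relation.Unary.All.Properties as Allₚ
open import Function using (_∘_; id)
open import Relation.Binary.PropositionalEquality
  using (_≡_; refl; sym; trans; cong; subst; subst₂)
open import Relation.Nullary using (¬_; Dec; yes; no)
open import Relation.Nullary.Decidable using (_×-dec_; _→-dec_)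
open import Defs

-- Records and Horn rules

infix 9 _⟨_,_,_⟩

record Atom (X : Set) : Set where
  constructor _⟨_,_,_⟩
  field
    label       : ℕ
    arg₀ arg₁ arg₂ : X
open Atom

map-atom : ∀ {X Y : Set} → (X → Y) → Atom X → Atom Y
map-atom f (K ⟨ x , y , z ⟩) = K ⟨ f x , f y , f z ⟩

-- A rule for label K has the implicit first premise K ⟨ u₀ , u₁ , u₂ ⟩; its
-- premises mention six universal values, its conclusions also five
-- existential ones.
record Rule : Set where
  constructor _⟶_
  field
    premises    : Vec (Atom (Fin 6)) 2
    conclusions : Vec (Atom (Fin 6 ⊎ Fin 5)) 5
open Rule

trigger : ℕ → Atom (Fin 6)
trigger K = K ⟨ 0F , 1F , 2F ⟩

fill : ∀ {A : Set} n → A → List A → Vec A n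
fill zero    d xs       = []
fill (suc n) d []       = d ∷ fill n d []
fill (suc n) d (x ∷ xs) = x ∷ fill n d xs

-- The trigger itself fills the unused places, which then say nothing.
rule : ℕ → List (Atom (Fin 6)) → List (Atom (Fin 6 ⊎ Fin 5)) → Rule
rule K ps cs = fill 2 (trigger K) ps ⟶ fill 5 (map-atom inj₁ (trigger K)) cs

Sat : {D : Set} → (Atom D → Set) → ℕ → Rule → Set
Sat {D} R K ρ = (η : Vec D 6) →
  R (map-atom (lookup η) (trigger K)) →
  All (R ∘ map-atom (lookup η)) (premises ρ) →
  Σ (Vec D 5) λ θ → All (R ∘ map-atom [ lookup η , lookup θ ]) (conclusions ρ)

-- The label of a rule is its place in the whole list. So a label has at most one rule, and compiled
-- programs address one another by offsets.
Along : (ℕ → Rule → Set) → ℕ → List Rule → Set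
Along Q K []       = ⊤
Along Q K (ρ ∷ ρs) = Q K ρ × Along Q (suc K) ρs

along-++ˡ : ∀ {Q} K ρs {σs} → Along Q K (ρs ++ᴸ σs) → Along Q K ρs
along-++ˡ K []       h       = tt
along-++ˡ K (ρ ∷ ρs) (h , hs) = h , along-++ˡ (suc K) ρs hs

along-++ʳ : ∀ {Q} K ρs {σs} → Along Q K (ρs ++ᴸ σs) → Along Q (K + length ρs) σs
along-++ʳ {Q} K [] {σs} h = subst (λ k → Along Q k σs) (sym (+-identityʳ K)) h
along-++ʳ {Q} K (ρ ∷ ρs) {σs} (_ , hs) =
  subst (λ k → Along Q k σs) (sym (+-suc K (length ρs))) (along-++ʳ (suc K) ρs hs)

-- Rules for arithmetic and for recursive programs

pattern ZERO = 0
pattern SUCC = 1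
pattern CONS = 2
pattern BOT  = 3
pattern COPY = 4
pattern COPY-ZERO = 5
pattern COPY-SUCC = 6

-- call s a y: the program whose rules start at place s sends the input a to
-- the output y.
call : ∀ {X : Set} → ℕ → X → X → Atom X
call s a y = (7 + s) ⟨ a , y , y ⟩

pattern u₀ = inj₁ 0F
pattern u₁ = inj₁ 1F
pattern u₂ = inj₁ 2F
pattern u₃ = inj₁ 3F
pattern u₄ = inj₁ 4F
pattern u₅ = inj₁ 5F
pattern w₀ = inj₂ 0F
pattern w₁ = inj₂ 1F
pattern w₂ = inj₂ 2F
pattern w₃ = inj₂ 3F

-- Matrices contain no equality, so numbers are passed on by `COPY`, which rebuilds at its second
-- argument the numeral found at its first. As a label has only one rule, a case distinction issues
-- one record per case, each with its own label and a premise testing the case.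
arithmetic : List Rule
arithmetic =
  rule ZERO (SUCC ⟨ 0F , 3F , 3F ⟩ ∷ SUCC ⟨ 0F , 3F , 3F ⟩ ∷ []) (BOT ⟨ u₀ , u₀ , u₀ ⟩ ∷ []) ∷
  rule SUCC [] [] ∷
  rule CONS [] [] ∷
  rule BOT  [] [] ∷
  rule COPY [] (COPY-ZERO ⟨ u₀ , u₁ , u₁ ⟩ ∷ COPY-SUCC ⟨ u₀ , u₁ , u₁ ⟩ ∷ []) ∷
  rule COPY-ZERO (ZERO ⟨ 0F , 0F , 0F ⟩ ∷ []) (ZERO ⟨ u₁ , u₁ , u₁ ⟩ ∷ []) ∷
  rule COPY-SUCC (SUCC ⟨ 0F , 3F , 3F ⟩ ∷ [])
    (SUCC ⟨ u₁ , w₀ , w₀ ⟩ ∷ COPY ⟨ u₃ , w₀ , w₀ ⟩ ∷ []) ∷ []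

rule₊ : ℕ → List (Atom (Fin 6)) → List (Atom (Fin 6 ⊎ Fin 5)) → Rule
rule₊ s = rule (7 + s)

compile-proj : ∀ {k} → Fin k → ℕ → List Rule
compile-proj zero s =
  rule₊ s (CONS ⟨ 0F , 3F , 4F ⟩ ∷ []) (COPY ⟨ u₃ , u₁ , u₁ ⟩ ∷ []) ∷ []
compile-proj (suc i) s =
  rule₊ s (CONS ⟨ 0F , 3F , 4F ⟩ ∷ []) (call (suc s) u₄ u₁ ∷ []) ∷
  compile-proj i (suc s)

mutual
  compile : ∀ {k} → Rec k → ℕ → List Rule
  compile zer s = rule₊ s [] (ZERO ⟨ u₁ , u₁ , u₁ ⟩ ∷ []) ∷ []
  compile succ s =
    rule₊ s (CONS ⟨ 0F , 3F , 4F ⟩ ∷ []) (SUCC ⟨ u₁ , u₃ , u₃ ⟩ ∷ []) ∷ []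
  compile (proj i) s = compile-proj i s
  compile (comp f gs) s =
    let s₁ = suc s + length (compile-vec gs (suc s)) in
    rule₊ s [] (call (suc s) u₀ w₀ ∷ call s₁ w₀ u₁ ∷ []) ∷
    compile-vec gs (suc s) ++ᴸ compile f s₁
  compile (prec f g) s =
    let s₁ = 3 + s + length (compile f (3 + s)) in
    rule₊ s [] (call (1 + s) u₀ u₁ ∷ call (2 + s) u₀ u₁ ∷ []) ∷
    rule₊ (1 + s) (CONS ⟨ 0F , 3F , 4F ⟩ ∷ ZERO ⟨ 3F , 3F , 3F ⟩ ∷ [])
      (call (3 + s) u₄ u₁ ∷ []) ∷
    rule₊ (2 + s) (CONS ⟨ 0F , 3F , 4F ⟩ ∷ SUCC ⟨ 3F , 5F , 5F ⟩ ∷ [])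
      -- With `u₅` the predecessor n and `u₄` the tail xs, `w₁` is n ∷ xs, `w₀` is the value of the
      -- recursive call there, and `w₃` is n ∷ w₀ ∷ xs, the input of g.
      (CONS ⟨ w₁ , u₅ , u₄ ⟩ ∷ call s w₁ w₀ ∷ CONS ⟨ w₂ , w₀ , u₄ ⟩ ∷
       CONS ⟨ w₃ , u₅ , w₂ ⟩ ∷ call s₁ w₃ u₁ ∷ []) ∷
    compile f (3 + s) ++ᴸ compile g s₁
  -- The rule at 1 + s searches upwards from the head of its input; those at
  -- 2 + s and 3 + s inspect the value of f found there.
  compile (mu f) s =
    rule₊ s [] (ZERO ⟨ w₀ , w₀ , w₀ ⟩ ∷ CONS ⟨ w₁ , w₀ , u₀ ⟩ ∷ call (1 + s) w₁ u₁ ∷ []) ∷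
    rule₊ (1 + s) []
      (call (4 + s) u₀ w₀ ∷ (9 + s) ⟨ u₀ , w₀ , u₁ ⟩ ∷ (10 + s) ⟨ u₀ , w₀ , u₁ ⟩ ∷ []) ∷
    rule₊ (2 + s) (CONS ⟨ 0F , 3F , 4F ⟩ ∷ ZERO ⟨ 1F , 1F , 1F ⟩ ∷ [])
      (COPY ⟨ u₃ , u₂ , u₂ ⟩ ∷ []) ∷
    rule₊ (3 + s) (CONS ⟨ 0F , 3F , 4F ⟩ ∷ SUCC ⟨ 1F , 5F , 5F ⟩ ∷ [])
      (SUCC ⟨ w₀ , u₃ , u₃ ⟩ ∷ CONS ⟨ w₁ , w₀ , u₄ ⟩ ∷ call (1 + s) w₁ u₂ ∷ []) ∷
    compile f (4 + s)

  compile-vec : ∀ {k i} → Vec (Rec k) i → ℕ → List Rule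
  compile-vec [] s = rule₊ s [] [] ∷ []
  compile-vec (g ∷ gs) s =
    let s₁ = suc s + length (compile g (suc s)) in
    rule₊ s [] (CONS ⟨ u₁ , w₀ , w₁ ⟩ ∷ call (suc s) u₀ w₀ ∷ call s₁ u₀ w₁ ∷ []) ∷
    compile g (suc s) ++ᴸ compile-vec gs s₁

-- Soundness of the rules

module Soundness {D : Set} (R : Atom D → Set)
                 (arithmetic-sat : Along (Sat R) 0 arithmetic) where

  -- R is arbitrary, so one value may represent several numbers. All that the argument has to
  -- separate is zero from successors, which `zero-not-suc` does.
  Num : D → ℕ → Set
  Num d zero    = R (ZERO ⟨ d , d , d ⟩)
  Num d (suc n) = Σ D λ d′ → R (SUCC ⟨ d , d′ , d′ ⟩) × Num d′ n

  -- The arity fixes the length, so lists need no end marker and any value may stand for the empty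
  -- list.
  Lst : ∀ {k} → D → Vec ℕ k → Set
  Lst a []       = ⊤
  Lst a (x ∷ xs) = Σ D λ h → Σ D λ t → R (CONS ⟨ a , h , t ⟩) × Num h x × Lst t xs

  copy-num : ∀ n {x y} → Num x n → R (COPY ⟨ x , y , y ⟩) → Num y n
  copy-num n {x} {y} hx c =
    let _ , _ , _ , _ , copy , _ = arithmetic-sat
        _ , copied = copy (x ∷ y ∷ y ∷ y ∷ y ∷ y ∷ []) c (c ∷ c ∷ [])
    in go n hx (All.head copied) (All.head (All.tail copied))
    where
    go : ∀ n {x y} → Num x n → R (COPY-ZERO ⟨ x , y , y ⟩) → R (COPY-SUCC ⟨ x , y , y ⟩) → Num y n
    go zero {x} {y} hx cz cs =
      let _ , _ , _ , _ , _ , copy-zero , _ = arithmetic-sat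
      in All.head (proj₂ (copy-zero (x ∷ y ∷ y ∷ y ∷ y ∷ y ∷ []) cz (hx ∷ cz ∷ [])))
    go (suc n) {x} {y} (x′ , sx , hx′) cz cs
      with (let _ , _ , _ , _ , _ , _ , copy-succ , _ = arithmetic-sat in
            copy-succ (x ∷ y ∷ y ∷ x′ ∷ y ∷ y ∷ []) cs (sx ∷ cs ∷ []))
    ... | y′ ∷ _ , sy ∷ c′ ∷ _ = y′ , sy , copy-num n hx′ c′

  zero-not-suc : (∀ d → ¬ R (BOT ⟨ d , d , d ⟩)) →
    ∀ {d n} → R (ZERO ⟨ d , d , d ⟩) → ¬ Num d (suc n)
  zero-not-suc no-bot {d} z (d′ , s , _)
    with proj₁ arithmetic-sat (d ∷ d ∷ d ∷ d′ ∷ d ∷ d ∷ []) z (s ∷ s ∷ [])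
  ... | _ , b ∷ _ = no-bot d b

  sound-proj : ∀ {k} (i : Fin k) s → Along (Sat R) (7 + s) (compile-proj i s) →
    ∀ {xs a y} → Lst a xs → R (call s a y) → Num y (lookup xs i)
  sound-proj zero s (p , _) {x ∷ xs} {a} {y} (h , t , c , hx , _) r
    with p (a ∷ y ∷ y ∷ h ∷ t ∷ y ∷ []) r (c ∷ r ∷ [])
  ... | _ , cp ∷ _ = copy-num x hx cp
  sound-proj (suc i) s (p , ps) {x ∷ xs} {a} {y} (h , t , c , _ , ht) r
    with p (a ∷ y ∷ y ∷ h ∷ t ∷ y ∷ []) r (c ∷ r ∷ [])
  ... | _ , r′ ∷ _ = sound-proj i (suc s) ps ht r′

  mutual
    -- Induction on the actual computation, which dictates the chain of records to follow; spurious
    -- records elsewhere in R do no harm.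
    sound : ∀ {k} (f : Rec k) s → Along (Sat R) (7 + s) (compile f s) →
      ∀ {xs n a y} → f [ xs ]⇓ n → Lst a xs → R (call s a y) → Num y n
    sound zer s (p , _) {a = a} {y} zer⇓ _ r
      with p (a ∷ y ∷ y ∷ y ∷ y ∷ y ∷ []) r (r ∷ r ∷ [])
    ... | _ , z ∷ _ = z
    sound succ s (p , _) {a = a} {y} succ⇓ (h , t , c , hx , _) r
      with p (a ∷ y ∷ y ∷ h ∷ t ∷ y ∷ []) r (c ∷ r ∷ [])
    ... | _ , sy ∷ _ = h , sy , hx
    sound (proj i) s ps (proj⇓ .i) l r = sound-proj i s ps l r
    sound (comp f gs) s (p , ps) {a = a} {y} (comp⇓ ds d) l r
      with p (a ∷ y ∷ y ∷ y ∷ y ∷ y ∷ []) r (r ∷ r ∷ [])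
    ... | b ∷ _ , r₁ ∷ r₂ ∷ _ =
      sound f _ (along-++ʳ (8 + s) (compile-vec gs (suc s)) ps) d
        (sound-vec gs (suc s) (along-++ˡ (8 + s) (compile-vec gs (suc s)) ps) ds l r₁) r₂
    sound (prec f g) s ps d l r = sound-prec f g s ps d l r
    sound (mu f) s ps@(p , _) {a = a} {y} (mu⇓ {y = n} d ds) l r
      with p (a ∷ y ∷ y ∷ y ∷ y ∷ y ∷ []) r (r ∷ r ∷ [])
    ... | o ∷ b ∷ _ , z ∷ c ∷ r₁ ∷ _ =
      sound-mu f s ps d ds n 0 (+-identityʳ n) (o , a , c , z , l) r₁

    sound-prec : ∀ {k} (f : Rec k) g s → Along (Sat R) (7 + s) (compile (prec f g) s) →
      ∀ {xs n a y} → prec f g [ xs ]⇓ n → Lst a xs → R (call s a y) → Num y n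
    sound-prec f g s (p₀ , p₁ , p₂ , ps) {a = a} {y} d l r
      with p₀ (a ∷ y ∷ y ∷ y ∷ y ∷ y ∷ []) r (r ∷ r ∷ [])
    sound-prec f g s (p₀ , p₁ , p₂ , ps) {a = a} {y} (prec⇓0 d) (h , t , c , z , l) r
      | _ , r₁ ∷ _ ∷ _
      with p₁ (a ∷ y ∷ y ∷ h ∷ t ∷ y ∷ []) r₁ (c ∷ z ∷ [])
    ... | _ , r′ ∷ _ = sound f (3 + s) (along-++ˡ (10 + s) (compile f (3 + s)) ps) d l r′
    sound-prec f g s qs@(p₀ , p₁ , p₂ , ps) {a = a} {y} (prec⇓s d d′) (h , t , c , (h′ , sh , hn) , l) r
      | _ , _ ∷ r₂ ∷ _
      with p₂ (a ∷ y ∷ y ∷ h ∷ t ∷ h′ ∷ []) r₂ (c ∷ sh ∷ [])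
    ... | v ∷ b₁ ∷ b₂ ∷ b₃ ∷ _ , c₁ ∷ r′ ∷ c₂ ∷ c₃ ∷ r″ ∷ _ =
      sound g _ (along-++ʳ (10 + s) (compile f (3 + s)) ps) d′
        (h′ , b₂ , c₃ , hn , v , t , c₂ , sound-prec f g s qs d (h′ , t , c₁ , hn , l) r′ , l) r″

    -- Induction on the distance j from the current candidate z to the least zero n. The actual
    -- value of f at z tells which of the two test rules to use.
    sound-mu : ∀ {k} (f : Rec (suc k)) s → Along (Sat R) (7 + s) (compile (mu f) s) →
      ∀ {xs n} → f [ n ∷ xs ]⇓ 0 → (∀ z → z < n → ∃[ w ] f [ z ∷ xs ]⇓ suc w) →
      ∀ j z → j + z ≡ n → ∀ {a y} → Lst a (z ∷ xs) → R (call (1 + s) a y) → Num y n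
    sound-mu f s qs@(p₀ , p₁ , p₂ , p₃ , ps) d ds j z e {a} {y} l@(h , t , c , hz , lt) r
      with p₁ (a ∷ y ∷ y ∷ y ∷ y ∷ y ∷ []) r (r ∷ r ∷ [])
    sound-mu f s qs@(p₀ , p₁ , p₂ , p₃ , ps) d ds zero z refl {a} {y} l@(h , t , c , hz , lt) r
      | o ∷ _ , r₁ ∷ r₂ ∷ _
      with p₂ (a ∷ o ∷ y ∷ h ∷ t ∷ y ∷ []) r₂ (c ∷ sound f (4 + s) ps d l r₁ ∷ [])
    ... | _ , cp ∷ _ = copy-num z hz cp
    sound-mu f s qs@(p₀ , p₁ , p₂ , p₃ , ps) d ds (suc j) z refl {a} {y} l@(h , t , c , hz , lt) r
      | o ∷ _ , r₁ ∷ _ ∷ r₃ ∷ _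
      with ds z (s≤s (m≤n+m z j))
    ... | w , dz with sound f (4 + s) ps dz l r₁
    ... | o′ , so , _
      with p₃ (a ∷ o ∷ y ∷ h ∷ t ∷ o′ ∷ []) r₃ (c ∷ so ∷ [])
    ... | z′ ∷ b ∷ _ , sz ∷ c′ ∷ r′ ∷ _ =
      sound-mu f s qs d ds j (suc z) (+-suc j z) (z′ , t , c′ , (h , sz , hz) , lt) r′

    sound-vec : ∀ {k i} (gs : Vec (Rec k) i) s → Along (Sat R) (7 + s) (compile-vec gs s) →
      ∀ {xs} {ys : Vec ℕ i} {a b} → Pointwise (λ g y → g [ xs ]⇓ y) gs ys → Lst a xs →
      R (call s a b) → Lst b ys
    sound-vec [] s _ [] _ _ = tt
    sound-vec (g ∷ gs) s (p , ps) {a = a} {b} (d ∷ ds) l r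
      with p (a ∷ b ∷ b ∷ b ∷ b ∷ b ∷ []) r (r ∷ r ∷ [])
    ... | v ∷ t ∷ _ , c ∷ r₁ ∷ r₂ ∷ _ =
      v , t , c ,
      sound g (suc s) (along-++ˡ (8 + s) (compile g (suc s)) ps) d l r₁ ,
      sound-vec gs _ (along-++ʳ (8 + s) (compile g (suc s)) ps) ds l r₂

-- Finite sets of true records

nth : List Rule → ℕ → Rule
nth []       _       = rule 0 [] []
nth (ρ ∷ ρs) zero    = ρ
nth (ρ ∷ ρs) (suc K) = nth ρs K

along-nth : ∀ ρs → Along (λ K ρ → nth ρs K ≡ ρ) 0 ρs
along-nth ρs = go ρs 0 λ _ → refl
  where
  go : ∀ σs s → (∀ K → nth ρs (s + K) ≡ nth σs K) → Along (λ K ρ → nth ρs K ≡ ρ) s σs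
  go []       s h = tt
  go (σ ∷ σs) s h =
    trans (cong (nth ρs) (sym (+-identityʳ s))) (h 0) ,
    go σs (suc s) λ K → trans (cong (nth ρs) (sym (+-suc s K))) (h (suc K))

list-code : ∀ {k} → Vec ℕ k → ℕ
list-code []       = 0
list-code (x ∷ xs) = pair x (list-code xs)

-- Labels from `COPY` on carry no truth condition: the premises that rules add to their triggers are
-- `ZERO`, `SUCC` and `CONS` records only. Numbers and codes of lists share the same values, with 0
-- for the empty list.
True : Atom ℕ → Set
True (ZERO ⟨ a , b , c ⟩) = a ≡ 0 × b ≡ 0 × c ≡ 0
True (SUCC ⟨ a , b , c ⟩) = a ≡ suc b × c ≡ b
True (CONS ⟨ a , b , c ⟩) = a ≡ pair b c
True (BOT  ⟨ a , b , c ⟩) = ⊥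
True _                    = ⊤

module Completeness (program : List Rule) where

  rules : List Rule
  rules = arithmetic ++ᴸ program

  -- Premises are only required to be true, not to lie in L; this makes
  -- justification monotone in L.
  Justified : List (Atom ℕ) → Rule → Atom ℕ → Set
  Justified L ρ (K ⟨ a , b , c ⟩) = ∀ d e f → let η = a ∷ b ∷ c ∷ d ∷ e ∷ f ∷ [] in
    All (True ∘ map-atom (lookup η)) (premises ρ) →
    Σ (Vec ℕ 5) λ θ → All (λ A → map-atom [ lookup η , lookup θ ] A ∈ L) (conclusions ρ)

  Closed : List (Atom ℕ) → Set
  Closed L = ∀ {r} → r ∈ L → True r × Justified L (nth rules (label r)) r

  Derivable : Atom ℕ → Set
  Derivable r = Σ (List (Atom ℕ)) λ L → Closed L × r ∈ L

  justified-mono : ∀ {L L′ ρ} r → (∀ {x} → x ∈ L → x ∈ L′) →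
    Justified L ρ r → Justified L′ ρ r
  justified-mono _ sub j d e f ps with j d e f ps
  ... | θ , cs = θ , All.map sub cs

  collect : ∀ {rs} → Allᴸ Derivable rs →
    Σ (List (Atom ℕ)) λ L → Closed L × (∀ {r} → r ∈ rs → r ∈ L)
  collect [] = [] , (λ ()) , (λ ())
  collect ((L , cl , r∈L) ∷ ds) with collect ds
  ... | L′ , cl′ , sub =
    L ++ᴸ L′ , closed , λ { (here refl) → ∈-++⁺ˡ r∈L ; (there i) → ∈-++⁺ʳ L (sub i) }
    where
    closed : Closed (L ++ᴸ L′)
    closed {r} i with ∈-++⁻ L i
    ... | inj₁ j = proj₁ (cl j) , justified-mono r ∈-++⁺ˡ (proj₂ (cl j))
    ... | inj₂ j = proj₁ (cl′ j) , justified-mono r (∈-++⁺ʳ L) (proj₂ (cl′ j))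

  -- Older records stay justified in the larger set by `justified-mono`. The new record r is
  -- available to its own conclusions, since those that pad a rule repeat the trigger.
  derive : ∀ {r ρ rs} → nth rules (label r) ≡ ρ → True r → Allᴸ Derivable rs →
    Justified (r ∷ rs) ρ r → Derivable r
  derive {r} refl t ds j with collect ds
  ... | L , cl , sub = r ∷ L , closed , here refl
    where
    closed : Closed (r ∷ L)
    closed (here refl) =
      t , justified-mono r (λ { (here e) → here e ; (there i) → there (sub i) }) j
    closed {r′} (there i) = proj₁ (cl i) , justified-mono r′ there (proj₂ (cl i))

  pattern 0th = here refl
  pattern 1st = there 0th
  pattern 2nd = there 1st
  pattern 3rd = there 2nd
  pattern 4th = there 3rd
  pattern 5th = there 4th

  pad : Vec ℕ 5
  pad = 0 ∷ 0 ∷ 0 ∷ 0 ∷ 0 ∷ []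

  derive-zero : Derivable (ZERO ⟨ 0 , 0 , 0 ⟩)
  derive-zero = derive refl (refl , refl , refl) [] λ { _ _ _ ((() , _) ∷ _) }

  derive-suc : ∀ n → Derivable (SUCC ⟨ suc n , n , n ⟩)
  derive-suc n = derive refl (refl , refl) [] λ _ _ _ _ →
    pad , 0th ∷ 0th ∷ 0th ∷ 0th ∷ 0th ∷ []

  derive-cons : ∀ x y → Derivable (CONS ⟨ pair x y , x , y ⟩)
  derive-cons x y = derive refl refl [] λ _ _ _ _ →
    pad , 0th ∷ 0th ∷ 0th ∷ 0th ∷ 0th ∷ []

  derive-copy : ∀ n → Derivable (COPY ⟨ n , n , n ⟩)
  derive-copy n = derive refl tt (derive-copy-zero n ∷ derive-copy-suc n ∷ []) λ _ _ _ _ →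
    pad , 1st ∷ 2nd ∷ 0th ∷ 0th ∷ 0th ∷ []
    where
    derive-copy-zero : ∀ n → Derivable (COPY-ZERO ⟨ n , n , n ⟩)
    derive-copy-zero zero = derive refl tt (derive-zero ∷ []) λ _ _ _ _ →
      pad , 1st ∷ 0th ∷ 0th ∷ 0th ∷ 0th ∷ []
    derive-copy-zero (suc n) = derive refl tt [] λ { _ _ _ ((() , _) ∷ _) }

    derive-copy-suc : ∀ n → Derivable (COPY-SUCC ⟨ n , n , n ⟩)
    derive-copy-suc zero = derive refl tt [] λ { _ _ _ ((() , _) ∷ _) }
    derive-copy-suc (suc n) = derive refl tt (derive-suc n ∷ derive-copy n ∷ []) λ
      { _ _ _ ((refl , _) ∷ _) → (n ∷ pad′) , 1st ∷ 2nd ∷ 0th ∷ 0th ∷ 0th ∷ [] }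
      where
      pad′ : Vec ℕ 4
      pad′ = 0 ∷ 0 ∷ 0 ∷ 0 ∷ []

  Placed : ℕ → List Rule → Set
  Placed s ρs = Along (λ K ρ → nth rules K ≡ ρ) (7 + s) ρs

  -- `pair` is injective, so the premise `CONS` forces d and e to be the head x and the tail y; only
  -- f and the second premise are left to treat.
  derive-on-list : ∀ {K b c rs p cs} x y →
    nth rules K ≡ ((CONS ⟨ 0F , 3F , 4F ⟩ ∷ p ∷ []) ⟶ cs) →
    let r = K ⟨ pair x y , b , c ⟩ in
    True r → Allᴸ Derivable rs →
    (∀ f → let η = pair x y ∷ b ∷ c ∷ x ∷ y ∷ f ∷ [] in True (map-atom (lookup η) p) →
      Σ (Vec ℕ 5) λ θ → All (λ A → map-atom [ lookup η , lookup θ ] A ∈ r ∷ rs) cs) →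
    Derivable r
  derive-on-list {K} {b} {c} {rs} {p} {cs} x y e t ds j = derive e t ds justified
    where
    justified : Justified (K ⟨ pair x y , b , c ⟩ ∷ rs)
      ((CONS ⟨ 0F , 3F , 4F ⟩ ∷ p ∷ []) ⟶ cs) (K ⟨ pair x y , b , c ⟩)
    justified d e f (q ∷ h ∷ []) with pair-injective x y {d} {e} q
    ... | refl , refl = j f h

  complete-proj : ∀ {k} (i : Fin k) s → Placed s (compile-proj i s) →
    ∀ xs → Derivable (call s (list-code xs) (lookup xs i))
  complete-proj zero s (p , _) (x ∷ xs) =
    derive-on-list x (list-code xs) p tt (derive-copy x ∷ []) λ _ _ →
      pad , 1st ∷ 0th ∷ 0th ∷ 0th ∷ 0th ∷ []
  complete-proj (suc i) s (p , ps) (x ∷ xs) =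
    derive-on-list x (list-code xs) p tt (complete-proj i (suc s) ps xs ∷ []) λ _ _ →
      pad , 1st ∷ 0th ∷ 0th ∷ 0th ∷ 0th ∷ []

  mutual
    complete : ∀ {k} (f : Rec k) s → Placed s (compile f s) →
      ∀ {xs n} → f [ xs ]⇓ n → Derivable (call s (list-code xs) n)
    complete zer s (p , _) zer⇓ =
      derive p tt (derive-zero ∷ []) λ _ _ _ _ → pad , 1st ∷ 0th ∷ 0th ∷ 0th ∷ 0th ∷ []
    complete succ s (p , _) (succ⇓ {x}) =
      derive-on-list x 0 p tt (derive-suc x ∷ []) λ _ _ →
        pad , 1st ∷ 0th ∷ 0th ∷ 0th ∷ 0th ∷ []
    complete (proj i) s ps {xs} (proj⇓ .i) = complete-proj i s ps xs
    complete (comp f gs) s (p , ps) (comp⇓ {ys = ys} ds d) =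
      derive p tt
        (complete-vec gs (suc s) (along-++ˡ (8 + s) (compile-vec gs (suc s)) ps) ds ∷
         complete f _ (along-++ʳ (8 + s) (compile-vec gs (suc s)) ps) d ∷ []) λ _ _ _ _ →
        (list-code ys ∷ 0 ∷ 0 ∷ 0 ∷ 0 ∷ []) , 1st ∷ 2nd ∷ 0th ∷ 0th ∷ 0th ∷ []
    complete (prec f g) s ps d = complete-prec f g s ps d
    complete (mu f) s ps@(p , _) {xs} {n} (mu⇓ d ds) =
      derive p tt
        (derive-zero ∷ derive-cons 0 (list-code xs) ∷
         complete-mu f s ps d ds n 0 (+-identityʳ n) ∷ []) λ _ _ _ _ →
        (0 ∷ pair 0 (list-code xs) ∷ 0 ∷ 0 ∷ 0 ∷ []) , 1st ∷ 2nd ∷ 3rd ∷ 0th ∷ 0th ∷ []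

    complete-prec : ∀ {k} (f : Rec k) g s → Placed s (compile (prec f g) s) →
      ∀ {xs n} → prec f g [ xs ]⇓ n → Derivable (call s (list-code xs) n)
    complete-prec f g s (p₀ , p₁ , p₂ , ps) (prec⇓0 {xs = xs} d) =
      derive p₀ tt
        (derive-on-list 0 (list-code xs) p₁ tt
           (complete f (3 + s) (along-++ˡ (10 + s) (compile f (3 + s)) ps) d ∷ []) (λ _ _ →
           pad , 1st ∷ 0th ∷ 0th ∷ 0th ∷ 0th ∷ []) ∷
         -- The record for the case that does not occur must be present too; its test premise is
         -- false, so it asks for no conclusions.
         derive-on-list 0 (list-code xs) p₂ tt [] (λ { _ (() , _) }) ∷ []) λ _ _ _ _ →
        pad , 1st ∷ 2nd ∷ 0th ∷ 0th ∷ 0th ∷ []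
    complete-prec f g s qs@(p₀ , p₁ , p₂ , ps) (prec⇓s {xs = xs} {n} {y} d d′) =
      derive p₀ tt
        (derive-on-list (suc n) t p₁ tt [] (λ { _ (() , _) }) ∷
         derive-on-list (suc n) t p₂ tt
           (derive-cons n t ∷ complete-prec f g s qs d ∷ derive-cons y t ∷
            derive-cons n (pair y t) ∷
            complete g _ (along-++ʳ (10 + s) (compile f (3 + s)) ps) d′ ∷ [])
           (λ { _ (refl , _) →
           (y ∷ pair n t ∷ pair y t ∷ pair n (pair y t) ∷ 0 ∷ []) ,
           1st ∷ 2nd ∷ 3rd ∷ 4th ∷ 5th ∷ [] }) ∷ []) λ _ _ _ _ →
        pad , 1st ∷ 2nd ∷ 0th ∷ 0th ∷ 0th ∷ []
      where
      t : ℕ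
      t = list-code xs

    complete-mu : ∀ {k} (f : Rec (suc k)) s → Placed s (compile (mu f) s) →
      ∀ {xs n} → f [ n ∷ xs ]⇓ 0 → (∀ z → z < n → ∃[ w ] f [ z ∷ xs ]⇓ suc w) →
      ∀ j z → j + z ≡ n → Derivable (call (1 + s) (list-code (z ∷ xs)) n)
    complete-mu f s (p₀ , p₁ , p₂ , p₃ , ps) {xs} d ds zero z refl =
      derive p₁ tt
        (complete f (4 + s) ps d ∷
         derive-on-list z t p₂ tt (derive-copy z ∷ []) (λ _ _ →
           pad , 1st ∷ 0th ∷ 0th ∷ 0th ∷ 0th ∷ []) ∷
         derive-on-list z t p₃ tt [] (λ { _ (() , _) }) ∷ []) λ _ _ _ _ →
        pad , 1st ∷ 2nd ∷ 3rd ∷ 0th ∷ 0th ∷ []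
      where
      t : ℕ
      t = list-code xs
    complete-mu f s qs@(p₀ , p₁ , p₂ , p₃ , ps) {xs} d ds (suc j) z refl
      with ds z (s≤s (m≤n+m z j))
    ... | w , dz =
      derive p₁ tt
        (complete f (4 + s) ps dz ∷
         derive-on-list z t p₂ tt [] (λ { _ (() , _) }) ∷
         derive-on-list z t p₃ tt
           (derive-suc z ∷ derive-cons (suc z) t ∷
            complete-mu f s qs d ds j (suc z) (+-suc j z) ∷ []) (λ { _ _ →
           (suc z ∷ pair (suc z) t ∷ 0 ∷ 0 ∷ 0 ∷ []) ,
           1st ∷ 2nd ∷ 3rd ∷ 0th ∷ 0th ∷ [] }) ∷ []) λ _ _ _ _ →
        (suc w ∷ 0 ∷ 0 ∷ 0 ∷ 0 ∷ []) , 1st ∷ 2nd ∷ 3rd ∷ 0th ∷ 0th ∷ []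
      where
      t : ℕ
      t = list-code xs

    complete-vec : ∀ {k i} (gs : Vec (Rec k) i) s → Placed s (compile-vec gs s) →
      ∀ {xs} {ys : Vec ℕ i} → Pointwise (λ g y → g [ xs ]⇓ y) gs ys →
      Derivable (call s (list-code xs) (list-code ys))
    complete-vec [] s (p , _) [] =
      derive p tt [] λ _ _ _ _ → pad , 0th ∷ 0th ∷ 0th ∷ 0th ∷ 0th ∷ []
    complete-vec (g ∷ gs) s (p , ps) (_∷_ {x = _} {y} {xs = _} {ys} d ds) =
      derive p tt
        (derive-cons y (list-code ys) ∷
         complete g (suc s) (along-++ˡ (8 + s) (compile g (suc s)) ps) d ∷
         complete-vec gs _ (along-++ʳ (8 + s) (compile g (suc s)) ps) ds ∷ []) λ _ _ _ _ →
        (y ∷ list-code ys ∷ 0 ∷ 0 ∷ 0 ∷ []) , 1st ∷ 2nd ∷ 3rd ∷ 0th ∷ 0th ∷ []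

-- Quantifier-free matrices

-- Variables come in blocks of five: places 0, 1 and 2 of a block form a value,
-- place 3 is a record and place 4 a label.
data Block : Set where
  U : Fin 6 → Block
  W : Fin 5 → Block
  C : ℕ → Block

data Var : Set where
  _∙_ : Block → Fin 5 → Var

infix  8 _∙_
infix  7 _~_
infixr 6 _&_
infixr 5 _⊃_

data Matrix : Set where
  _~_     : Var → Var → Matrix
  _&_ _⊃_ : Matrix → Matrix → Matrix

-- Indexed by `suc n` because there is no matrix for truth to start from.
⋀ : ∀ n → (Fin (suc n) → Matrix) → Matrix
⋀ zero    φ = φ zero
⋀ (suc n) φ = φ zero & ⋀ n (φ ∘ suc)

⟦_⟧ : Matrix → {A : Set} → (A → A → Set) → (Block → Fin 5 → A) → Set
⟦ (σ ∙ p) ~ (τ ∙ q) ⟧ E ρ = E (ρ σ p) (ρ τ q)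
⟦ φ & ψ ⟧             E ρ = ⟦ φ ⟧ E ρ × ⟦ ψ ⟧ E ρ
⟦ φ ⊃ ψ ⟧             E ρ = ⟦ φ ⟧ E ρ → ⟦ ψ ⟧ E ρ

module _ {A : Set} {E : A → A → Set} {ρ : Block → Fin 5 → A} where

  ⋀-intro : ∀ n {φ} → (∀ i → ⟦ φ i ⟧ E ρ) → ⟦ ⋀ n φ ⟧ E ρ
  ⋀-intro zero    h = h zero
  ⋀-intro (suc n) h = h zero , ⋀-intro n (h ∘ suc)

  ⋀-elim : ∀ n {φ} → ⟦ ⋀ n φ ⟧ E ρ → ∀ i → ⟦ φ i ⟧ E ρ
  ⋀-elim zero    h       zero    = h
  ⋀-elim (suc n) (h , _) zero    = h
  ⋀-elim (suc n) (_ , h) (suc i) = ⋀-elim n h i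

decide : ∀ {A : Set} {E : A → A → Set} → (∀ x y → Dec (E x y)) →
  ∀ φ ρ → Dec (⟦ φ ⟧ E ρ)
decide E? ((σ ∙ p) ~ (τ ∙ q)) ρ = E? (ρ σ p) (ρ τ q)
decide E? (φ & ψ) ρ = decide E? φ ρ ×-dec decide E? ψ ρ
decide E? (φ ⊃ ψ) ρ = decide E? φ ρ →-dec decide E? ψ ρ

-- Translation into formulas and their codes

Bounded-var : ℕ → Var → Set
Bounded-var N (U _ ∙ _) = ⊤
Bounded-var N (W _ ∙ _) = ⊤
Bounded-var N (C k ∙ _) = k ≤ N

Bounded : ℕ → Matrix → Set
Bounded N (v ~ w) = Bounded-var N v × Bounded-var N w
Bounded N (φ & ψ) = Bounded N φ × Bounded N ψ
Bounded N (φ ⊃ ψ) = Bounded N φ × Bounded N ψ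

-- Makes `position` total: indices beyond N go to N, and `Bounded` keeps them from occurring.
clip : ∀ N → ℕ → Fin (suc N)
clip N       zero    = zero
clip zero    (suc k) = zero
clip (suc N) (suc k) = suc (clip N k)

toℕ-clip : ∀ {N k} → k ≤ N → toℕ (clip N k) ≡ k
toℕ-clip z≤n       = refl
toℕ-clip (s≤s k≤N) = cong suc (toℕ-clip k≤N)

-- Innermost first: 25 = 5 * 5 variables for the blocks `W`, 30 = 6 * 5 for the blocks `U`, then
-- five for each constant block. The `+ 0` is the one in `Prenex-∃*∀∃∀`.
Context : ℕ → ℕ
Context N = 25 + (30 + (suc N * 5 + 0))

position : ∀ N → Var → Fin (Context N)
position N (W i ∙ p) = combine i p ↑ˡ (30 + (suc N * 5 + 0))
position N (U i ∙ p) = 25 ↑ʳ (combine i p ↑ˡ (suc N * 5 + 0))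
position N (C k ∙ p) = 25 ↑ʳ (30 ↑ʳ (combine (clip N k) p ↑ˡ 0))

formula : ∀ N → Matrix → Formula (Context N)
formula N (v ~ w) = position N v ∼ position N w
formula N (φ & ψ) = formula N φ ∧ formula N ψ
formula N (φ ⊃ ψ) = formula N φ ⇒ formula N ψ

formula-qf : ∀ N φ → QuantifierFree (formula N φ)
formula-qf N (v ~ w) = position N v ∼ position N w
formula-qf N (φ & ψ) = formula-qf N φ ∧ formula-qf N ψ
formula-qf N (φ ⊃ ψ) = formula-qf N φ ⇒ formula-qf N ψ

-- The constants are bound outermost, so indices do not depend on how many constants there are.
-- Hence a matrix keeps its code under longer prefixes, as the diagonal argument needs.
var-code : Var → ℕ
var-code (W i ∙ p) = 5 * toℕ i + toℕ p
var-code (U i ∙ p) = 25 + (5 * toℕ i + toℕ p)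
var-code (C k ∙ p) = 25 + (30 + (5 * k + toℕ p))

-- Unfolding pair during conversion checking would be exponential.
opaque

  ⟪_,_⟫ : ℕ → ℕ → ℕ
  ⟪ a , b ⟫ = pair a b

  pair≡⟪⟫ : ∀ a b → pair a b ≡ ⟪ a , b ⟫
  pair≡⟪⟫ a b = refl

  nested : ∀ t {a b c d} → a ≡ c → b ≡ d → pair t (pair a b) ≡ ⟪ t , ⟪ c , d ⟫ ⟫
  nested t refl refl = refl

matrix-code : Matrix → ℕ
matrix-code (v ~ w) = ⟪ 1 , ⟪ var-code v , var-code w ⟫ ⟫
matrix-code (φ & ψ) = ⟪ 3 , ⟪ matrix-code φ , matrix-code ψ ⟫ ⟫
matrix-code (φ ⊃ ψ) = ⟪ 5 , ⟪ matrix-code φ , matrix-code ψ ⟫ ⟫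

position-code : ∀ {N} v → Bounded-var N v → toℕ (position N v) ≡ var-code v
position-code {N} (W i ∙ p) _ =
  trans (toℕ-↑ˡ (combine i p) _) (toℕ-combine i p)
position-code {N} (U i ∙ p) _ =
  trans (toℕ-↑ʳ 25 _) (cong (25 +_) (trans (toℕ-↑ˡ (combine i p) _) (toℕ-combine i p)))
position-code {N} (C k ∙ p) k≤N =
  trans (toℕ-↑ʳ 25 _) (cong (25 +_)
    (trans (toℕ-↑ʳ 30 _) (cong (30 +_)
      (trans (toℕ-↑ˡ (combine (clip N k) p) 0)
        (trans (toℕ-combine (clip N k) p) (cong (λ j → 5 * j + toℕ p) (toℕ-clip k≤N)))))))

formula-code : ∀ {N} φ → Bounded N φ → code (formula N φ) ≡ matrix-code φ
formula-code (v ~ w) (b , c) = nested 1 (position-code v b) (position-code w c)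
formula-code (φ & ψ) (b , c) = nested 3 (formula-code φ b) (formula-code ψ c)
formula-code (φ ⊃ ψ) (b , c) = nested 5 (formula-code φ b) (formula-code ψ c)

opaque
  unfolding ⟪_,_⟫

  right≤pair : ∀ a b → b ≤ ⟪ a , b ⟫
  right≤pair a b = ≤-trans (≤-trans (m≤n*m b 2) (n≤1+n (2 * b)))
    (m≤n*m (suc (2 * b)) (2 ^ a) {{m^n≢0 2 a}})

  left≤pair : ∀ a b → a ≤ ⟪ a , b ⟫
  left≤pair zero    b = z≤n
  left≤pair (suc a) b = ≤-trans (s≤s (left≤pair a b))
    (subst (suc (pair a b) ≤_) (sym (*-assoc 2 (2 ^ a) (suc (2 * b))))
      (+-mono-≤ (*-mono-≤ (m^n>0 2 a) (s≤s z≤n))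
         (≤-reflexive (sym (+-identityʳ (pair a b))))))

bounded-var : ∀ {N} v → var-code v ≤ N → Bounded-var N v
bounded-var (U i ∙ p) h = tt
bounded-var (W i ∙ p) h = tt
bounded-var (C k ∙ p) h =
  ≤-trans (≤-trans (m≤n*m k 5) (≤-trans (m≤m+n (5 * k) (toℕ p)) (m≤n+m _ 55))) h

-- A code is at least as large as every constant index in its matrix. So if x is the code of the
-- program matrix, a prefix computed from x alone binds all its constants.
bounded : ∀ {N} φ → matrix-code φ ≤ N → Bounded N φ
bounded-pair : ∀ {N} t φ ψ → ⟪ t , ⟪ matrix-code φ , matrix-code ψ ⟫ ⟫ ≤ N →
  Bounded N φ × Bounded N ψ
bounded (v ~ w) h =
  bounded-var v (≤-trans (≤-trans (left≤pair (var-code v) (var-code w)) (right≤pair 1 _)) h) ,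
  bounded-var w (≤-trans (≤-trans (right≤pair (var-code v) (var-code w)) (right≤pair 1 _)) h)
bounded (φ & ψ) h = bounded-pair 3 φ ψ h
bounded (φ ⊃ ψ) h = bounded-pair 5 φ ψ h
bounded-pair t φ ψ h =
  bounded φ (≤-trans (≤-trans (left≤pair (matrix-code φ) (matrix-code ψ)) (right≤pair t _)) h) ,
  bounded ψ (≤-trans (≤-trans (right≤pair (matrix-code φ) (matrix-code ψ)) (right≤pair t _)) h)

-- Truth of prenex sentences in a graph

blocks : ∀ {A : Set} {m} → (Fin m → Fin 5 → A) → Vec A (m * 5)
blocks f = tabulate (uncurry f ∘ remQuot 5)

lookup-blocks : ∀ {A : Set} {m} (f : Fin m → Fin 5 → A) i p →
  lookup (blocks f) (combine i p) ≡ f i p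
lookup-blocks f i p =
  trans (lookup∘tabulate (uncurry f ∘ remQuot 5) (combine i p))
    (cong (uncurry f) (remQuot-combine i p))

environment : ∀ {A : Set} → (Fin 6 → Fin 5 → A) → (Fin 5 → Fin 5 → A) → (ℕ → Fin 5 → A) →
  Block → Fin 5 → A
environment u w c (U i) = u i
environment u w c (W i) = w i
environment u w c (C k) = c k

module _ (G : FiniteGraph) where
  open FiniteGraph G

  all^-elim : ∀ n {k} (φ : Formula (n + k)) {ρ} →
    Holds G (all^ n φ) ρ → ∀ us → Holds G φ (us ++ ρ)
  all^-elim zero    φ h []       = h
  all^-elim (suc n) φ h (u ∷ us) = all^-elim n (all φ) h us u

  all^-intro : ∀ n {k} (φ : Formula (n + k)) {ρ} →
    (∀ us → Holds G φ (us ++ ρ)) → Holds G (all^ n φ) ρ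
  all^-intro zero    φ h = h []
  all^-intro (suc n) φ h = all^-intro n (all φ) λ us u → h (u ∷ us)

  ex^-elim : ∀ n {k} (φ : Formula (n + k)) {ρ} →
    Holds G (ex^ n φ) ρ → ∃[ us ] Holds G φ (us ++ ρ)
  ex^-elim zero    φ h = [] , h
  ex^-elim (suc n) φ h with ex^-elim n (ex φ) h
  ... | us , u , h′ = u ∷ us , h′

  ex^-intro : ∀ n {k} (φ : Formula (n + k)) {ρ} us →
    Holds G φ (us ++ ρ) → Holds G (ex^ n φ) ρ
  ex^-intro zero    φ []       h = h
  ex^-intro (suc n) φ (u ∷ us) h = ex^-intro n (ex φ) us (u , h)

  -- Vertices are read in A along h; this lets the model below be described by
  -- an infinite graph A of which G is a finite part.
  module Matrices {A : Set} (E : A → A → Set) (h : Vertex → A)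
                  (to : ∀ {u v} → Adj u v → E (h u) (h v))
                  (from : ∀ {u v} → E (h u) (h v) → Adj u v) where

    formula-holds : ∀ {N} φ → Bounded N φ → ∀ {ρ : Vec Vertex (Context N)} {θ} →
      (∀ σ p → Bounded-var N (σ ∙ p) → h (lookup ρ (position N (σ ∙ p))) ≡ θ σ p) →
      (Holds G (formula N φ) ρ → ⟦ φ ⟧ E θ) × (⟦ φ ⟧ E θ → Holds G (formula N φ) ρ)
    formula-holds ((σ ∙ p) ~ (τ ∙ q)) (b , c) e rewrite sym (e σ p b) | sym (e τ q c) =
      to , from
    formula-holds (φ & ψ) (b , c) e with formula-holds φ b e | formula-holds ψ c e
    ... | f , f⁻ | g , g⁻ = (λ (x , y) → f x , g y) , (λ (x , y) → f⁻ x , g⁻ y)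
    formula-holds (φ ⊃ ψ) (b , c) e with formula-holds φ b e | formula-holds ψ c e
    ... | f , f⁻ | g , g⁻ = (λ x y → g (x (f⁻ y))) , (λ x y → g⁻ (x (f y)))

    lookup-environment : ∀ {N} (us : Vec Vertex 30) (ws : Vec Vertex 25)
      (cs : Vec Vertex (suc N * 5)) {u w c} →
      (∀ i p → h (lookup us (combine {6} {5} i p)) ≡ u i p) →
      (∀ i p → h (lookup ws (combine {5} {5} i p)) ≡ w i p) →
      (∀ k p → k ≤ N → h (lookup cs (combine (clip N k) p)) ≡ c k p) →
      ∀ σ p → Bounded-var N (σ ∙ p) →
      h (lookup (ws ++ us ++ cs ++ []) (position N (σ ∙ p))) ≡ environment u w c σ p
    lookup-environment us ws cs hu hw hc (U i) p b =
      trans (cong h (trans (lookup-++ʳ ws _ _) (lookup-++ˡ us _ (combine i p)))) (hu i p)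
    lookup-environment us ws cs hu hw hc (W i) p b =
      trans (cong h (lookup-++ˡ ws _ (combine i p))) (hw i p)
    lookup-environment {N} us ws cs hu hw hc (C k) p b =
      trans (cong h (trans (lookup-++ʳ ws _ _) (trans (lookup-++ʳ us _ _)
        (lookup-++ˡ cs [] (combine (clip N k) p))))) (hc k p b)

sentence : ℕ → Matrix → Sentence
sentence N φ = ex^ (suc N * 5) (all^ 30 (ex^ 25 (formula N φ)))

module _ (G : FiniteGraph) where
  open FiniteGraph G

  sentence-elim : ∀ {N φ} → Bounded N φ → G ⊨ sentence N φ →
    Σ (ℕ → Fin 5 → Vertex) λ c → ∀ u → Σ (Fin 5 → Fin 5 → Vertex) λ w →
      ⟦ φ ⟧ Adj (environment u w c)
  sentence-elim {N} {φ} b s with ex^-elim G (suc N * 5) (all^ 30 (ex^ 25 (formula N φ))) s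
  ... | cs , s′ = c , λ u → matrix u
    where
    open Matrices G Adj id id id
    c : ℕ → Fin 5 → Vertex
    c k p = lookup cs (combine (clip N k) p)
    matrix : ∀ u → Σ (Fin 5 → Fin 5 → Vertex) λ w → ⟦ φ ⟧ Adj (environment u w c)
    matrix u with ex^-elim G 25 (formula N φ) (all^-elim G 30 (ex^ 25 (formula N φ)) s′ (blocks u))
    ... | ws , s″ = (λ i p → lookup ws (combine i p)) ,
      proj₁ (formula-holds φ b
        (lookup-environment (blocks u) ws cs (lookup-blocks u) (λ _ _ → refl) (λ _ _ _ → refl))) s″

  sentence-intro : ∀ {A : Set} (E : A → A → Set) (h : Vertex → A)
    (to : ∀ {u v} → Adj u v → E (h u) (h v)) (from : ∀ {u v} → E (h u) (h v) → Adj u v) →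
    ∀ {N φ} → Bounded N φ → (c : ℕ → Fin 5 → A) →
    (∀ k p → k ≤ N → ∃[ v ] h v ≡ c k p) →
    (∀ (u : Fin 6 → Fin 5 → Vertex) → Σ (Fin 5 → Fin 5 → Vertex) λ w →
      ⟦ φ ⟧ E (environment (λ i → h ∘ u i) (λ i → h ∘ w i) c)) →
    G ⊨ sentence N φ
  sentence-intro E h to from {N} {φ} b c hc m =
    ex^-intro G (suc N * 5) (all^ 30 (ex^ 25 (formula N φ))) cs
      (all^-intro G 30 (ex^ 25 (formula N φ)) λ us →
      let w , s = m (λ i p → lookup us (combine i p)) in
      ex^-intro G 25 (formula N φ) (blocks w)
        (proj₂ (formula-holds φ b (lookup-environment us (blocks w) cs
          (λ _ _ → refl) (λ i p → cong h (lookup-blocks w i p)) hcs)) s))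
    where
    open Matrices G E h to from
    c′ : Fin (suc N) → Fin 5 → Vertex
    c′ i p = proj₁ (hc (toℕ i) p (toℕ≤pred[n] i))
    cs : Vec Vertex (suc N * 5)
    cs = blocks c′
    hcs : ∀ k p → k ≤ N → h (lookup cs (combine (clip N k) p)) ≡ c k p
    hcs k p k≤N = trans (cong h (lookup-blocks c′ (clip N k) p))
      (trans (proj₂ (hc _ p _)) (cong (λ j → c j p) (toℕ-clip k≤N)))

-- Symmetric adjacency cannot order the arguments of a record, so a value has one vertex for each
-- argument place, marked by a label and tied together by edges at the first.
is-value : Block → Matrix
is-value σ =
  σ ∙ 0F ~ C 0 ∙ 4F & σ ∙ 1F ~ C 1 ∙ 4F & σ ∙ 2F ~ C 2 ∙ 4F &
  σ ∙ 0F ~ σ ∙ 1F & σ ∙ 0F ~ σ ∙ 2F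

-- The labels 0, 1 and 2 mark the three vertices of a value, so those of the
-- records are shifted by 3.
is-record : Block → Atom Block → Matrix
is-record τ A =
  τ ∙ 3F ~ C (3 + label A) ∙ 4F &
  τ ∙ 3F ~ arg₀ A ∙ 0F & τ ∙ 3F ~ arg₁ A ∙ 1F & τ ∙ 3F ~ arg₂ A ∙ 2F

premise-place : Fin 2 → Fin 6
premise-place i = suc (i ↑ˡ 3)

premise-matrix : ℕ → Rule → Matrix
premise-matrix K ρ =
  ⋀ 5 (is-value ∘ U) & is-record (U 0F) (map-atom U (trigger K)) &
  ⋀ 1 (λ i → is-record (U (premise-place i)) (map-atom U (lookup (premises ρ) i)))

conclusion-matrix : Rule → Matrix
conclusion-matrix ρ =
  ⋀ 4 (is-value ∘ W) &
  ⋀ 4 (λ i → is-record (W i) (map-atom [ U , W ] (lookup (conclusions ρ) i)))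

-- The last conjunct uses a loop, impossible in a graph, as the false formula: no record is labelled
-- `BOT`.
rules-matrix : ℕ → List Rule → Matrix
rules-matrix K []       = U 0F ∙ 3F ~ C (3 + BOT) ∙ 4F ⊃ U 0F ∙ 3F ~ U 0F ∙ 3F
rules-matrix K (ρ ∷ ρs) =
  (premise-matrix K ρ ⊃ conclusion-matrix ρ) & rules-matrix (suc K) ρs

-- Block 2 + k is the number k.
numerals : ℕ → Matrix
numerals zero    = is-value (C 2) & is-record (C 2) (ZERO ⟨ C 2 , C 2 , C 2 ⟩)
numerals (suc k) =
  (is-value (C (3 + k)) & is-record (C (3 + k)) (SUCC ⟨ C (3 + k) , C (2 + k) , C (2 + k) ⟩)) &
  numerals k

-- Block 2 is both the output 0 and the empty tail of the input list, which is block 0. The record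
-- of block 0 builds this list, that of block 1 is the call of the program.
halts-with-0-on : ℕ → Matrix
halts-with-0-on x =
  (is-value (C 0) & is-record (C 0) (CONS ⟨ C 0 , C (2 + x) , C 2 ⟩) &
   is-record (C 1) (call 0 (C 0) (C 2))) &
  numerals x

program-matrix : Rec 1 → Matrix
program-matrix f = rules-matrix 0 (arithmetic ++ᴸ compile f 0)

halting-matrix : Rec 1 → ℕ → Matrix
halting-matrix f x = program-matrix f & halts-with-0-on x

-- From a graph to an interpretation of the rules

module Reading (G : FiniteGraph) (c : ℕ → Fin 5 → FiniteGraph.Vertex G) where
  open FiniteGraph G

  Value : (Fin 5 → Vertex) → Set
  Value d = Adj (d 0F) (c 0 4F) × Adj (d 1F) (c 1 4F) × Adj (d 2F) (c 2 4F) ×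
            Adj (d 0F) (d 1F) × Adj (d 0F) (d 2F)

  D : Set
  D = Σ (Fin 5 → Vertex) Value

  R : Atom D → Set
  R (K ⟨ x , y , z ⟩) = Σ Vertex λ r →
    Adj r (c (3 + K) 4F) × Adj r (proj₁ x 0F) × Adj r (proj₁ y 1F) × Adj r (proj₁ z 2F)

  Models : Matrix → Set
  Models φ = ∀ u → Σ (Fin 5 → Fin 5 → Vertex) λ w → ⟦ φ ⟧ Adj (environment u w c)

  reading-rule : ∀ K ρ → Models (premise-matrix K ρ ⊃ conclusion-matrix ρ) → Sat R K ρ
  reading-rule K ρ@((_ ∷ _ ∷ []) ⟶ cs@(_ ∷ _ ∷ _ ∷ _ ∷ _ ∷ [])) m η r (q₁ ∷ q₂ ∷ []) =
    θ , conclude 0F ∷ conclude 1F ∷ conclude 2F ∷ conclude 3F ∷ conclude 4F ∷ []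
    where
    -- Premise records go where `premise-place` expects them; the trigger record belongs to block 0
    -- and is the default elsewhere.
    recs : Fin 6 → Vertex
    recs 1F = proj₁ q₁
    recs 2F = proj₁ q₂
    recs _  = proj₁ r

    u : Fin 6 → Fin 5 → Vertex
    u i 3F = recs i
    u i p  = proj₁ (lookup η i) p

    w : Fin 5 → Fin 5 → Vertex
    w = proj₁ (m u)

    ρ′ : Block → Fin 5 → Vertex
    ρ′ = environment u w c

    conclusions-hold : ⟦ conclusion-matrix ρ ⟧ Adj ρ′
    conclusions-hold = proj₂ (m u)
      (⋀-intro {E = Adj} {ρ′} 5 {is-value ∘ U} (λ i → proj₂ (lookup η i)) , proj₂ r , proj₂ q₁ , proj₂ q₂)

    d : Fin 5 → D
    d i = w i , ⋀-elim {E = Adj} {ρ′} 4 {is-value ∘ W} (proj₁ conclusions-hold) i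

    θ : Vec D 5
    θ = tabulate d

    val : Fin 6 ⊎ Fin 5 → D
    val = [ lookup η , lookup θ ]

    same : ∀ x → let e = ρ′ ([ U , W ] x); v = proj₁ (val x) in
      e 0F ≡ v 0F × e 1F ≡ v 1F × e 2F ≡ v 2F
    same (inj₁ i) = refl , refl , refl
    same (inj₂ j) rewrite lookup∘tabulate d j = refl , refl , refl

    conclude : ∀ i → R (map-atom val (lookup cs i))
    conclude i with ⋀-elim {E = Adj} {ρ′} 4 {λ i → is-record (W i) (map-atom [ U , W ] (lookup cs i))}
                      (proj₂ conclusions-hold) i
    ... | l , a , b , e =
      let A = lookup cs i in
      w i 3F , l ,
      subst (Adj (w i 3F)) (proj₁ (same (arg₀ A))) a ,
      subst (Adj (w i 3F)) (proj₁ (proj₂ (same (arg₁ A)))) b ,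
      subst (Adj (w i 3F)) (proj₂ (proj₂ (same (arg₂ A)))) e

  reading : ∀ K ρs → Models (rules-matrix K ρs) → Along (Sat R) K ρs
  reading K []       m = tt
  reading K (ρ ∷ ρs) m =
    reading-rule K ρ (λ u → proj₁ (m u) , proj₁ (proj₂ (m u))) ,
    reading (suc K) ρs (λ u → proj₁ (m u) , proj₂ (proj₂ (m u)))

  no-bot : ∀ K ρs → Models (rules-matrix K ρs) → ∀ d → ¬ R (BOT ⟨ d , d , d ⟩)
  -- With all universal variables set to r, the conjunct turns the edge from r to the label into a
  -- loop at r.
  no-bot K []       m d (r , l , _) = irreflexive refl (proj₂ (m λ _ _ → r) l)
  no-bot K (ρ ∷ ρs) m = no-bot (suc K) ρs (λ u → proj₁ (m u) , proj₂ (proj₂ (m u)))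

  -- The graph records the output 0 for f at x, while soundness makes the same value represent
  -- `suc n`; `zero-not-suc` excludes this.
  no-model-of-other-value : ∀ {f x n} → f [ x ∷ [] ]⇓ suc n →
    ¬ Models (halting-matrix f x)
  no-model-of-other-value {f} {x} {n} f⇓ m = contradiction
    where
    rules-hold : Models (program-matrix f)
    rules-hold u = proj₁ (m u) , proj₁ (proj₂ (m u))

    sat : Along (Sat R) 0 (arithmetic ++ᴸ compile f 0)
    sat = reading 0 (arithmetic ++ᴸ compile f 0) rules-hold

    open Soundness R (along-++ˡ 0 arithmetic sat)

    -- `halts-with-0-on x` concerns constants only, so any universal vertices reveal it.
    any : Fin 6 → Fin 5 → Vertex
    any _ _ = zero

    start : ⟦ halts-with-0-on x ⟧ Adj (environment any (proj₁ (m any)) c)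
    start = proj₂ (proj₂ (m any))

    numeral : ∀ k u w → ⟦ numerals k ⟧ Adj (environment u w c) →
      Σ (Value (c (2 + k))) λ v → Num (c (2 + k) , v) k
    numeral zero    u w (v , z) = v , (c 2 3F , z)
    numeral (suc k) u w ((v , s) , ns) =
      v , (c (2 + k) , _) , (c (3 + k) 3F , s) , proj₂ (numeral k u w ns)

    value-0 : ∀ k u w → ⟦ numerals k ⟧ Adj (environment u w c) →
      Σ (Value (c 2)) λ v → R (ZERO ⟨ (c 2 , v) , (c 2 , v) , (c 2 , v) ⟩)
    value-0 zero    u w ns       = numeral 0 u w ns
    value-0 (suc k) u w (_ , ns) = value-0 k u w ns

    contradiction : ⊥
    contradiction with start
    ... | (v , cons , run) , ns
      with value-0 x any (proj₁ (m any)) ns | numeral x any (proj₁ (m any)) ns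
    ... | v₀ , z | vₓ , hx =
      zero-not-suc (no-bot 0 (arithmetic ++ᴸ compile f 0) rules-hold) {c 2 , v₀} {n} z
        (sound f 0 (along-++ʳ 0 arithmetic sat) {xs = x ∷ []} {a = c 0 , v} {c 2 , v₀} f⇓
          ((c (2 + x) , vₓ) , (c 2 , v₀) , (c 0 3F , cons) , hx , tt)
          (c 1 3F , run))

-- The finite graph of a halting computation

data Vtx : Set where
  label-vertex  : ℕ → Vtx
  value-vertex  : Fin 3 → ℕ → Vtx
  record-vertex : Atom ℕ → Vtx

arg : Fin 3 → Atom ℕ → ℕ
arg 0F = arg₀
arg 1F = arg₁
arg 2F = arg₂

adj : Vtx → Vtx → Bool
adj (label-vertex k)   (value-vertex p v) = toℕ p ≡ᵇ k
adj (value-vertex p v) (label-vertex k)   = toℕ p ≡ᵇ k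
adj (label-vertex k)   (record-vertex r)  = 3 + label r ≡ᵇ k
adj (record-vertex r)  (label-vertex k)   = 3 + label r ≡ᵇ k
adj (value-vertex p v) (record-vertex r)  = arg p r ≡ᵇ v
adj (record-vertex r)  (value-vertex p v) = arg p r ≡ᵇ v
adj (value-vertex 0F v)      (value-vertex (suc _) w) = v ≡ᵇ w
adj (value-vertex (suc _) v) (value-vertex 0F w)      = w ≡ᵇ v
adj _ _ = false

E : Vtx → Vtx → Set
E u v = T (adj u v)

E-symmetric : ∀ u v → E u v → E v u
E-symmetric (label-vertex k)   (value-vertex p v) h = h
E-symmetric (value-vertex p v) (label-vertex k)   h = h
E-symmetric (label-vertex k)   (record-vertex r)  h = h
E-symmetric (record-vertex r)  (label-vertex k)   h = h
E-symmetric (value-vertex 0F v) (record-vertex r) h = h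
E-symmetric (value-vertex 1F v) (record-vertex r) h = h
E-symmetric (value-vertex 2F v) (record-vertex r) h = h
E-symmetric (record-vertex r) (value-vertex 0F v) h = h
E-symmetric (record-vertex r) (value-vertex 1F v) h = h
E-symmetric (record-vertex r) (value-vertex 2F v) h = h
E-symmetric (value-vertex 0F v)      (value-vertex (suc _) w) h = h
E-symmetric (value-vertex (suc _) v) (value-vertex 0F w)      h = h

E-irreflexive : ∀ u → ¬ E u u
E-irreflexive (value-vertex 0F v)      ()
E-irreflexive (value-vertex (suc _) v) ()

Encodes : (Fin 5 → Vtx) → ℕ → Set
Encodes d v = d 0F ≡ value-vertex 0F v × d 1F ≡ value-vertex 1F v × d 2F ≡ value-vertex 2F v

decode-place : ∀ t p → E t (label-vertex (toℕ p)) → ∃[ v ] t ≡ value-vertex p v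
decode-place (value-vertex 0F v) 0F h = v , refl
decode-place (value-vertex 1F v) 1F h = v , refl
decode-place (value-vertex 2F v) 2F h = v , refl
decode-place (record-vertex r) 0F ()
decode-place (record-vertex r) 1F ()
decode-place (record-vertex r) 2F ()

decode-label : ∀ t K → E t (label-vertex (3 + K)) → ∃[ r ] t ≡ record-vertex r × label r ≡ K
decode-label (value-vertex 0F v) K ()
decode-label (value-vertex 1F v) K ()
decode-label (value-vertex 2F v) K ()
decode-label (record-vertex r) K h = r , refl , ≡ᵇ⇒≡ (label r) K h

module Decoding (u : Fin 6 → Fin 5 → Vtx) (w : Fin 5 → Fin 5 → Vtx) (c : ℕ → Fin 5 → Vtx)
                (labels : ∀ k → c k 4F ≡ label-vertex k) where

  private
    ρ : Block → Fin 5 → Vtx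
    ρ = environment u w c

  decode-value : ∀ σ → ⟦ is-value σ ⟧ E ρ → ∃[ v ] Encodes (ρ σ) v
  decode-value σ (h₀ , h₁ , h₂ , e₁ , e₂)
    with decode-place (ρ σ 0F) 0F (subst (E (ρ σ 0F)) (labels 0) h₀)
       | decode-place (ρ σ 1F) 1F (subst (E (ρ σ 1F)) (labels 1) h₁)
       | decode-place (ρ σ 2F) 2F (subst (E (ρ σ 2F)) (labels 2) h₂)
  ... | a , p | b , q | d , r
    with ≡ᵇ⇒≡ a b (subst₂ E p q e₁) | ≡ᵇ⇒≡ a d (subst₂ E p r e₂)
  ... | refl | refl = a , p , q , r

  encode-value : ∀ σ {v} → Encodes (ρ σ) v → ⟦ is-value σ ⟧ E ρ
  encode-value σ {v} (e₀ , e₁ , e₂)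
    rewrite labels 0 | labels 1 | labels 2 | e₀ | e₁ | e₂ =
    tt , tt , tt , ≡⇒≡ᵇ v v refl , ≡⇒≡ᵇ v v refl

  decode-record : ∀ τ A {v₀ v₁ v₂} →
    Encodes (ρ (arg₀ A)) v₀ → Encodes (ρ (arg₁ A)) v₁ → Encodes (ρ (arg₂ A)) v₂ →
    ⟦ is-record τ A ⟧ E ρ → ρ τ 3F ≡ record-vertex (label A ⟨ v₀ , v₁ , v₂ ⟩)
  decode-record τ (K ⟨ _ , _ , _ ⟩) {v₀ = v₀} {v₁} {v₂}
    (e₀ , _) (_ , e₁ , _) (_ , _ , e₂) (l , h₀ , h₁ , h₂)
    rewrite labels (3 + K) | e₀ | e₁ | e₂
    with ρ τ 3F | decode-label (ρ τ 3F) K l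
  ... | _ | (_ ⟨ a , b , d ⟩) , refl , refl
    with ≡ᵇ⇒≡ a v₀ h₀ | ≡ᵇ⇒≡ b v₁ h₁ | ≡ᵇ⇒≡ d v₂ h₂
  ... | refl | refl | refl = refl

  encode-record : ∀ τ A {v₀ v₁ v₂} →
    Encodes (ρ (arg₀ A)) v₀ → Encodes (ρ (arg₁ A)) v₁ → Encodes (ρ (arg₂ A)) v₂ →
    ρ τ 3F ≡ record-vertex (label A ⟨ v₀ , v₁ , v₂ ⟩) → ⟦ is-record τ A ⟧ E ρ
  encode-record τ (K ⟨ _ , _ , _ ⟩) {v₀ = v₀} {v₁} {v₂} (e₀ , _) (_ , e₁ , _) (_ , _ , e₂) e
    rewrite labels (3 + K) | e₀ | e₁ | e₂ | e =
    ≡⇒≡ᵇ K K refl , ≡⇒≡ᵇ v₀ v₀ refl , ≡⇒≡ᵇ v₁ v₁ refl , ≡⇒≡ᵇ v₂ v₂ refl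

bound : ∀ (L : List (Atom ℕ)) → ∃[ N ] (∀ {r} → r ∈ L → ∀ p → arg p r ≤ N)
bound [] = 0 , λ ()
bound (r@(_ ⟨ a , b , d ⟩) ∷ L) with bound L
... | N , h = a + (b + (d + N)) , λ
  { (here refl) 0F → m≤m+n a _
  ; (here refl) 1F → ≤-trans (m≤m+n b _) (m≤n+m _ a)
  ; (here refl) 2F → ≤-trans (m≤m+n d N) (≤-trans (m≤n+m _ b) (m≤n+m _ a))
  ; (there i) p → ≤-trans (h i p) (≤-trans (m≤n+m N d) (≤-trans (m≤n+m _ b) (m≤n+m _ a))) }

-- Contents of the constant blocks as `halts-with-0-on` and `numerals` describe them: `pair x 0`
-- codes the list [x], and block 1 gets a filler.
value-at : ℕ → ℕ → ℕ
value-at x 0             = pair x 0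
value-at x 1             = 0
value-at x (suc (suc k)) = k

record-at : ℕ → ℕ → Atom ℕ
record-at x 0 = CONS ⟨ pair x 0 , x , 0 ⟩
record-at x 1 = call 0 (pair x 0) 0
record-at x 2 = ZERO ⟨ 0 , 0 , 0 ⟩
record-at x (suc (suc (suc k))) = SUCC ⟨ suc k , k , k ⟩

module Model (f : Rec 1) (x : ℕ) (L : List (Atom ℕ))
             (closed : Completeness.Closed (compile f 0) L)
             (record-at∈L : ∀ {k} → k ≤ 10 + x → record-at x k ∈ L) where

  open Completeness (compile f 0)

  constant : ℕ → Fin 5 → Vtx
  constant k 0F = value-vertex 0F (value-at x k)
  constant k 1F = value-vertex 1F (value-at x k)
  constant k 2F = value-vertex 2F (value-at x k)
  constant k 3F = record-vertex (record-at x k)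
  constant k 4F = label-vertex k

  N : ℕ
  N = proj₁ (bound L)

  arg≤N : ∀ {r} → r ∈ L → ∀ p → arg p r ≤ N
  arg≤N = proj₂ (bound L)

  value-at≤N : ∀ {k} → k ≤ 10 + x → value-at x k ≤ N
  value-at≤N {0} h = arg≤N (record-at∈L h) 0F
  value-at≤N {1} h = z≤n
  value-at≤N {2} h = z≤n
  value-at≤N {suc (suc (suc k))} h = arg≤N (record-at∈L h) 0F

  values : List Vtx
  values = cartesianProductWith value-vertex (allFin 3) (upTo (suc N))

  vertices⁺ : List Vtx
  vertices⁺ = mapᴸ label-vertex (upTo (11 + x)) ++ᴸ values ++ᴸ mapᴸ record-vertex L

  -- `label-vertex 0` in front makes the domain nonempty. That it is listed twice, as records may be
  -- too, is harmless since the matrices contain no equality.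
  vertices : List Vtx
  vertices = label-vertex 0 ∷ vertices⁺

  vertex : Fin (length vertices) → Vtx
  vertex = lookupᴸ vertices

  label∈vertices : ∀ {k} → k ≤ 10 + x → label-vertex k ∈ vertices
  label∈vertices h = there (∈-++⁺ˡ (∈-map⁺ label-vertex (∈-upTo⁺ (s≤s h))))

  value∈vertices : ∀ p {v} → v ≤ N → value-vertex p v ∈ vertices
  value∈vertices p h = there (∈-++⁺ʳ (mapᴸ label-vertex (upTo (11 + x)))
    (∈-++⁺ˡ (∈-cartesianProductWith⁺ value-vertex (∈-allFin p) (∈-upTo⁺ (s≤s h)))))

  record∈vertices : ∀ {r} → r ∈ L → record-vertex r ∈ vertices
  record∈vertices i = there (∈-++⁺ʳ (mapᴸ label-vertex (upTo (11 + x)))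
    (∈-++⁺ʳ values (∈-map⁺ record-vertex i)))

  record∈vertices⁻ : ∀ {r} → record-vertex r ∈ vertices → r ∈ L
  record∈vertices⁻ (there i) with ∈-++⁻ (mapᴸ label-vertex (upTo (11 + x))) i
  ... | inj₁ j with ∈-map⁻ label-vertex j
  ... | _ , _ , ()
  record∈vertices⁻ (there i) | inj₂ j with ∈-++⁻ values j
  ... | inj₁ k with ∈-cartesianProductWith⁻ value-vertex (allFin 3) (upTo (suc N)) k
  ... | _ , _ , _ , _ , ()
  record∈vertices⁻ (there i) | inj₂ j | inj₂ k with ∈-map⁻ record-vertex k
  ... | _ , r∈L , refl = r∈L

  record-vertex⁻ : ∀ {i r} → vertex i ≡ record-vertex r → r ∈ L
  record-vertex⁻ {i} e = record∈vertices⁻ (subst (_∈ vertices) e (∈-lookup i))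

  locate : ∀ {v} → v ∈ vertices → ∃[ i ] vertex i ≡ v
  locate i = index i , sym (lookup-index i)

  G : FiniteGraph
  G = record
    { size-1      = length vertices⁺
    ; adjacent    = λ u v → adj (vertex u) (vertex v)
    ; symmetric   = λ {u} {v} → E-symmetric (vertex u) (vertex v)
    ; irreflexive = λ { {u} refl → E-irreflexive (vertex u) }
    }

  open FiniteGraph G using (Vertex)

  constant-vertex : ∀ k p → k ≤ 10 + x → ∃[ v ] vertex v ≡ constant k p
  constant-vertex k 0F h = locate (value∈vertices 0F (value-at≤N h))
  constant-vertex k 1F h = locate (value∈vertices 1F (value-at≤N h))
  constant-vertex k 2F h = locate (value∈vertices 2F (value-at≤N h))
  constant-vertex k 3F h = locate (record∈vertices (record-at∈L h))
  constant-vertex k 4F h = locate (label∈vertices h)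

  module _ (u : Fin 6 → Fin 5 → Vertex) where

    valuation : (Fin 5 → Fin 5 → Vertex) → Block → Fin 5 → Vtx
    valuation w = environment (λ i → vertex ∘ u i) (λ i → vertex ∘ w i) constant

    module At (w : Fin 5 → Fin 5 → Vertex) =
      Decoding (λ i → vertex ∘ u i) (λ i → vertex ∘ w i) constant (λ _ → refl)

    halts-holds : ∀ w → ⟦ halts-with-0-on x ⟧ E (valuation w)
    halts-holds w =
      (val 0 ,
       encode-record (C 0) (CONS ⟨ C 0 , C (2 + x) , C 2 ⟩) (enc 0) (enc (2 + x)) (enc 2) refl ,
       encode-record (C 1) (call 0 (C 0) (C 2)) (enc 0) (enc 2) (enc 2) refl) ,
      numerals-hold x
      where
      open At w
      enc : ∀ k → Encodes (valuation w (C k)) (value-at x k)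
      enc k = refl , refl , refl
      val : ∀ k → ⟦ is-value (C k) ⟧ E (valuation w)
      val k = encode-value (C k) (enc k)
      numerals-hold : ∀ k → ⟦ numerals k ⟧ E (valuation w)
      numerals-hold zero    =
        val 2 , encode-record (C 2) (ZERO ⟨ C 2 , C 2 , C 2 ⟩) (enc 2) (enc 2) (enc 2) refl
      numerals-hold (suc k) =
        (val (3 + k) ,
         encode-record (C (3 + k)) (SUCC ⟨ C (3 + k) , C (2 + k) , C (2 + k) ⟩)
           (enc (3 + k)) (enc (2 + k)) (enc (2 + k)) refl) ,
        numerals-hold k

    realise : ∀ ρ (θ : Vec ℕ 5) {η : Fin 6 → ℕ} →
      (∀ i → Encodes (vertex ∘ u i) (η i)) →
      All (λ A → map-atom [ η , lookup θ ] A ∈ L) (conclusions ρ) →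
      Σ (Fin 5 → Fin 5 → Vertex) λ w → ⟦ conclusion-matrix ρ ⟧ E (valuation w)
    realise (_ ⟶ cs) θ {η} hη hcs =
      w ,
      ⋀-intro {E = E} {valuation w} 4 {is-value ∘ W}
        (λ i → At.encode-value w (W i) (encodes-w i)) ,
      ⋀-intro {E = E} {valuation w} 4 {λ i → is-record (W i) (map-atom [ U , W ] (lookup cs i))} λ i →
        let r∈L = Allₚ.lookup⁺ hcs i in
        At.encode-record w (W i) (map-atom [ U , W ] (lookup cs i))
          (encodes (arg₀ (lookup cs i)) (arg≤N r∈L 0F))
          (encodes (arg₁ (lookup cs i)) (arg≤N r∈L 1F))
          (encodes (arg₂ (lookup cs i)) (arg≤N r∈L 2F))
          (proj₂ (locate (record∈vertices r∈L)))
      where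
      -- All five existential blocks must be values of G, even where θ has an entry outside every
      -- conclusion, so entries are cut off at N. Those occurring in conclusions are at most N and
      -- stay unchanged.
      value-located : ∀ i p → ∃[ v ] vertex v ≡ value-vertex p (lookup θ i ⊓ N)
      value-located i p = locate (value∈vertices p (m⊓n≤n (lookup θ i) N))

      w : Fin 5 → Fin 5 → Vertex
      w i 0F = proj₁ (value-located i 0F)
      w i 1F = proj₁ (value-located i 1F)
      w i 2F = proj₁ (value-located i 2F)
      w i 3F = proj₁ (locate (record∈vertices (Allₚ.lookup⁺ hcs i)))
      w i 4F = zero

      encodes-w : ∀ i → Encodes (valuation w (W i)) (lookup θ i ⊓ N)
      encodes-w i =
        proj₂ (value-located i 0F) , proj₂ (value-located i 1F) , proj₂ (value-located i 2F)

      val : Fin 6 ⊎ Fin 5 → ℕ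
      val = [ η , lookup θ ]

      encodes : ∀ σ → val σ ≤ N → Encodes (valuation w ([ U , W ] σ)) (val σ)
      encodes (inj₁ i) h = hη i
      encodes (inj₂ i) h = subst (Encodes (valuation w (W i))) (m≤n⇒m⊓n≡m h) (encodes-w i)

    -- The premise describes true records of L, so closedness of L applied to the trigger supplies
    -- the conclusions.
    respond : ∀ K ρ w → nth rules K ≡ ρ → ⟦ premise-matrix K ρ ⟧ E (valuation w) →
      Σ (Fin 5 → Fin 5 → Vertex) λ w → ⟦ conclusion-matrix ρ ⟧ E (valuation w)
    respond K ρ@(ps ⟶ _) w refl (values-hold , first-holds , premises-hold) =
      realise ρ (proj₁ justified) encodes (proj₂ justified)
      where
      decoded : ∀ i → ∃[ v ] Encodes (valuation w (U i)) v
      decoded i = At.decode-value w (U i)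
        (⋀-elim {E = E} {valuation w} 5 {is-value ∘ U} values-hold i)

      η : Vec ℕ 6
      η = tabulate (proj₁ ∘ decoded)

      encodes : ∀ i → Encodes (valuation w (U i)) (lookup η i)
      encodes i = subst (Encodes (valuation w (U i)))
        (sym (lookup∘tabulate (proj₁ ∘ decoded) i)) (proj₂ (decoded i))

      read : ∀ τ A → ⟦ is-record (U τ) (map-atom U A) ⟧ E (valuation w) →
        map-atom (lookup η) A ∈ L
      read τ A h = record-vertex⁻ {u τ 3F} (At.decode-record w (U τ) (map-atom U A)
        (encodes (arg₀ A)) (encodes (arg₁ A)) (encodes (arg₂ A)) h)

      justified : Σ (Vec ℕ 5) λ θ →
        All (λ A → map-atom [ lookup η , lookup θ ] A ∈ L) (conclusions ρ)
      justified = proj₂ (closed (read 0F (trigger K) first-holds)) _ _ _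
        (Allₚ.lookup⁻ λ i → proj₁ (closed (read (premise-place i) (lookup ps i)
          (⋀-elim {E = E} {valuation w} 1
            {λ i → is-record (U (premise-place i)) (map-atom U (lookup ps i))} premises-hold i))))

    no-bot-record : ∀ w → ⟦ rules-matrix 0 [] ⟧ E (valuation w)
    no-bot-record w h with decode-label (vertex (u 0F 3F)) BOT h
    ... | (_ ⟨ _ , _ , _ ⟩) , e , refl = ⊥-elim (proj₁ (closed (record-vertex⁻ {u 0F 3F} e)))

    premise-label : ∀ K ρ w → ⟦ premise-matrix K ρ ⟧ E (valuation w) →
      ∃[ r ] vertex (u 0F 3F) ≡ record-vertex r × label r ≡ K
    premise-label K ρ w p = decode-label (vertex (u 0F 3F)) K (proj₁ (proj₁ (proj₂ p)))

    other-label : ∀ {K r} → vertex (u 0F 3F) ≡ record-vertex r → label r < K →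
      ¬ (∃[ r ] vertex (u 0F 3F) ≡ record-vertex r × label r ≡ K)
    other-label e lt (r′ , e′ , refl) with trans (sym e) e′
    ... | refl = <-irrefl refl lt

    later-rules-hold : ∀ K ρs w {r} → vertex (u 0F 3F) ≡ record-vertex r → label r < K →
      ⟦ rules-matrix K ρs ⟧ E (valuation w)
    later-rules-hold K []       w e lt = no-bot-record w
    later-rules-hold K (ρ ∷ ρs) w e lt =
      (λ p → ⊥-elim (other-label e lt (premise-label K ρ w p))) ,
      later-rules-hold (suc K) ρs w e (m<n⇒m<1+n lt)

    default : Fin 5 → Fin 5 → Vertex
    default _ _ = zero

    Choice : ℕ → List Rule → Set
    Choice K ρs = Σ (Fin 5 → Fin 5 → Vertex) λ w → ⟦ rules-matrix K ρs ⟧ E (valuation w)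

    choose-triggered : ∀ K ρ ρs → nth rules K ≡ ρ →
      (p : ⟦ premise-matrix K ρ ⟧ E (valuation default)) →
      (∃[ r ] vertex (u 0F 3F) ≡ record-vertex r × label r ≡ K) → Choice K (ρ ∷ ρs)
    choose-triggered K ρ ρs e p (r , e′ , refl) =
      let w , h = respond K ρ default e p in
      w , (λ _ → h) , later-rules-hold (suc K) ρs w e′ (n<1+n K)

    choose-step : ∀ K ρ ρs → nth rules K ≡ ρ → Choice (suc K) ρs →
      Dec (⟦ premise-matrix K ρ ⟧ E (valuation default)) → Choice K (ρ ∷ ρs)
    -- Premises mention no existential block, so refuting one under `default` refutes it under w.
    choose-step K ρ ρs e (w , h) (no ¬p) = w , (λ p → ⊥-elim (¬p p)) , h
    choose-step K ρ ρs e _       (yes p) = choose-triggered K ρ ρs e p (premise-label K ρ default p)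

    -- All rules share one choice of existential vertices. This is possible because the record in
    -- the first universal block has a single label and so triggers at most one rule, whose response
    -- is taken; later rules then hold vacuously.
    choose : ∀ K ρs → Along (λ K ρ → nth rules K ≡ ρ) K ρs → Choice K ρs
    choose K []       _        = default , no-bot-record default
    choose K (ρ ∷ ρs) (e , es) = choose-step K ρ ρs e (choose (suc K) ρs es)
      (decide (λ x y → T? (adj x y)) (premise-matrix K ρ) (valuation default))

  holds-in-G : Bounded (10 + x) (halting-matrix f x) → G ⊨ sentence (10 + x) (halting-matrix f x)
  holds-in-G b =
    sentence-intro G E vertex id id {10 + x} {halting-matrix f x} b constant constant-vertex λ u →
      let w , h = choose u 0 rules (along-nth rules) in w , h , halts-holds u w

halting-model : ∀ f x → f [ x ∷ [] ]⇓ 0 → Bounded (10 + x) (halting-matrix f x) →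
  ∃[ G ] G ⊨ sentence (10 + x) (halting-matrix f x)
halting-model f x f⇓ b = Model.G f x L closed ∈L , Model.holds-in-G f x L closed ∈L b
  where
  open Completeness (compile f 0)

  placed : Placed 0 (compile f 0)
  placed = along-++ʳ 0 arithmetic (along-nth rules)

  derive-record-at : ∀ k → Derivable (record-at x k)
  derive-record-at 0 = derive-cons x 0
  derive-record-at 1 = complete f 0 placed f⇓
  derive-record-at 2 = derive-zero
  derive-record-at (suc (suc (suc k))) = derive-suc k

  derivable : Allᴸ Derivable (mapᴸ (record-at x) (upTo (11 + x)))
  -- Every leading quantifier needs a witness, so blocks past the numeral x are filled too, up to
  -- block 10 + x.
  derivable = Allᴸₚ.map⁺ (universal derive-record-at (upTo (11 + x)))

  L : List (Atom ℕ)
  L = proj₁ (collect derivable)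

  closed : Closed L
  closed = proj₁ (proj₂ (collect derivable))

  ∈L : ∀ {k} → k ≤ 10 + x → record-at x k ∈ L
  ∈L h = proj₂ (proj₂ (collect derivable)) (∈-map⁺ (record-at x) (∈-upTo⁺ (s≤s h)))

-- Computing the codes of the sentences

record Computable {k} (F : Vec ℕ k → ℕ) : Set where
  constructor _computes_
  field
    term   : Rec k
    value⇓ : ∀ xs → term [ xs ]⇓ F xs

placeᶜ : ∀ {k} (i : Fin k) → Computable (λ xs → lookup xs i)
placeᶜ i = proj i computes λ xs → proj⇓ i

zeroᶜ : ∀ {k} → Computable {k} (λ _ → 0)
zeroᶜ = comp zer [] computes λ xs → comp⇓ [] zer⇓

sucᶜ : ∀ {k} {F : Vec ℕ k → ℕ} → Computable F → Computable (suc ∘ F)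
sucᶜ (f computes f⇓) = comp succ (f ∷ []) computes λ xs → comp⇓ (f⇓ xs ∷ []) succ⇓

constᶜ : ∀ {k} n → Computable {k} (λ _ → n)
constᶜ zero    = zeroᶜ
constᶜ (suc n) = sucᶜ (constᶜ n)

_∘ᶜ_ : ∀ {k} {G : Vec ℕ 1 → ℕ} {F : Vec ℕ k → ℕ} →
  Computable G → Computable F →
  Computable (λ xs → G (F xs ∷ []))
(g computes g⇓) ∘ᶜ (f computes f⇓) =
  comp g (f ∷ []) computes λ xs → comp⇓ (f⇓ xs ∷ []) (g⇓ _)

binaryᶜ : ∀ {k} {G : Vec ℕ 2 → ℕ} {F F′ : Vec ℕ k → ℕ} →
  Computable G → Computable F → Computable F′ →
  Computable (λ xs → G (F xs ∷ F′ xs ∷ []))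
binaryᶜ (g computes g⇓) (f computes f⇓) (f′ computes f′⇓) =
  comp g (f ∷ f′ ∷ []) computes λ xs → comp⇓ (f⇓ xs ∷ f′⇓ xs ∷ []) (g⇓ _)

recᶜ : ∀ {k F G} {H : Vec ℕ (suc k) → ℕ} → Computable {k} F → Computable {2 + k} G →
  (∀ xs → F xs ≡ H (0 ∷ xs)) → (∀ n xs → G (n ∷ H (n ∷ xs) ∷ xs) ≡ H (suc n ∷ xs)) →
  Computable H
recᶜ {H = H} (f computes f⇓) (g computes g⇓) h₀ hₛ =
  prec f g computes λ { (n ∷ xs) → go n xs }
  where
  go : ∀ n xs → prec f g [ n ∷ xs ]⇓ H (n ∷ xs)
  go zero    xs = subst (prec f g [ 0 ∷ xs ]⇓_) (h₀ xs) (prec⇓0 (f⇓ xs))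
  go (suc n) xs = subst (prec f g [ suc n ∷ xs ]⇓_) (hₛ n xs) (prec⇓s (go n xs) (g⇓ _))

_+ᶜ_ : ∀ {k} {F G : Vec ℕ k → ℕ} → Computable F → Computable G → Computable (λ xs → F xs + G xs)
_+ᶜ_ = binaryᶜ {G = λ xs → lookup xs 0F + lookup xs 1F}
  (recᶜ (placeᶜ 0F) (sucᶜ (placeᶜ 1F)) (λ _ → refl) (λ _ _ → refl))

opaque
  unfolding ⟪_,_⟫

  pairᶜ : ∀ {k} {F G : Vec ℕ k → ℕ} → Computable F → Computable G →
    Computable (λ xs → ⟪ F xs , G xs ⟫)
  pairᶜ = binaryᶜ {G = λ xs → ⟪ lookup xs 0F , lookup xs 1F ⟫}
    -- Recursion on the first component: start from `suc (2 * b)` and keep doubling. A product by 2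
    -- unfolds to a sum ending in 0, hence `zeroᶜ`.
    (recᶜ {F = λ xs → suc (2 * lookup xs 0F)} {G = λ xs → 2 * lookup xs 1F}
      (sucᶜ (placeᶜ 0F +ᶜ (placeᶜ 0F +ᶜ zeroᶜ)))
      (placeᶜ 1F +ᶜ (placeᶜ 1F +ᶜ zeroᶜ))
      (λ { (b ∷ []) → sym (*-identityˡ _) })
      (λ { a (b ∷ []) → sym (*-assoc 2 (2 ^ a) _) }))

edgeᶜ : ∀ {k} {F G : Vec ℕ k → ℕ} → Computable F → ∀ p → Computable G → ∀ q →
  Computable (λ xs → matrix-code (C (F xs) ∙ p ~ C (G xs) ∙ q))
edgeᶜ {k} f p g q = pairᶜ (constᶜ 1) (pairᶜ (varᶜ f p) (varᶜ g q))
  where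
  varᶜ : ∀ {F : Vec ℕ k → ℕ} → Computable F → ∀ p → Computable (λ xs → var-code (C (F xs) ∙ p))
  varᶜ f p = constᶜ 25 +ᶜ (constᶜ 30 +ᶜ
    ((f +ᶜ (f +ᶜ (f +ᶜ (f +ᶜ (f +ᶜ zeroᶜ))))) +ᶜ constᶜ (toℕ p)))

infixr 6 _&ᶜ_

_&ᶜ_ : ∀ {k} {F G : Vec ℕ k → ℕ} → Computable F → Computable G →
  Computable (λ xs → ⟪ 3 , ⟪ F xs , G xs ⟫ ⟫)
f &ᶜ g = pairᶜ (constᶜ 3) (pairᶜ f g)

is-valueᶜ : ∀ {k} {F : Vec ℕ k → ℕ} → Computable F →
  Computable (λ xs → matrix-code (is-value (C (F xs))))
is-valueᶜ f =
  edgeᶜ f 0F (constᶜ 0) 4F &ᶜ edgeᶜ f 1F (constᶜ 1) 4F &ᶜ edgeᶜ f 2F (constᶜ 2) 4F &ᶜ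
  edgeᶜ f 0F f 1F &ᶜ edgeᶜ f 0F f 2F

is-recordᶜ : ∀ {k} {F G₀ G₁ G₂ : Vec ℕ k → ℕ} → Computable F → ∀ K →
  Computable G₀ → Computable G₁ → Computable G₂ →
  Computable (λ xs → matrix-code (is-record (C (F xs)) (K ⟨ C (G₀ xs) , C (G₁ xs) , C (G₂ xs) ⟩)))
is-recordᶜ f K g₀ g₁ g₂ =
  edgeᶜ f 3F (constᶜ (3 + K)) 4F &ᶜ edgeᶜ f 3F g₀ 0F &ᶜ edgeᶜ f 3F g₁ 1F &ᶜ edgeᶜ f 3F g₂ 2F

numeralsᶜ : Computable {1} (λ xs → matrix-code (numerals (lookup xs 0F)))
numeralsᶜ = recᶜ
  (is-valueᶜ (constᶜ 2) &ᶜ is-recordᶜ (constᶜ 2) ZERO (constᶜ 2) (constᶜ 2) (constᶜ 2))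
  ((is-valueᶜ (constᶜ 3 +ᶜ placeᶜ 0F) &ᶜ
    is-recordᶜ (constᶜ 3 +ᶜ placeᶜ 0F) SUCC (constᶜ 3 +ᶜ placeᶜ 0F)
      (constᶜ 2 +ᶜ placeᶜ 0F) (constᶜ 2 +ᶜ placeᶜ 0F)) &ᶜ placeᶜ 1F)
  (λ _ → refl) (λ _ _ → refl)

halts-with-0-onᶜ : Computable {1} (λ xs → matrix-code (halts-with-0-on (lookup xs 0F)))
halts-with-0-onᶜ =
  (is-valueᶜ (constᶜ 0) &ᶜ
   is-recordᶜ (constᶜ 0) CONS (constᶜ 0) (constᶜ 2 +ᶜ placeᶜ 0F) (constᶜ 2) &ᶜ
   is-recordᶜ (constᶜ 1) 7 (constᶜ 0) (constᶜ 2) (constᶜ 2)) &ᶜ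
  numeralsᶜ

foldᶜ : ∀ {k} t {F G : Vec ℕ k → ℕ} → Computable F → Computable G →
  Computable (λ xs → fold (F xs) ⟪ t ,_⟫ (G xs))
foldᶜ t f g = binaryᶜ {G = λ xs → fold (lookup xs 1F) ⟪ t ,_⟫ (lookup xs 0F)}
  (recᶜ (placeᶜ 0F) (pairᶜ (constᶜ t) (placeᶜ 1F)) (λ _ → refl) (λ _ _ → refl)) g f

prefix-code : ℕ → ℕ → ℕ
prefix-code j y = fold (fold (fold y ⟪ 7 ,_⟫ 25) ⟪ 6 ,_⟫ 30) ⟪ 7 ,_⟫ j

-- When x is the code of a matrix M, this is the code of the sentence with
-- matrix M & halts-with-0-on x.
code-from : ℕ → ℕ
code-from x =
  prefix-code ((11 + x) * 5) ⟪ 3 , ⟪ x , matrix-code (halts-with-0-on x) ⟫ ⟫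

code-fromᶜ : Computable {1} (λ xs → code-from (lookup xs 0F))
code-fromᶜ =
  foldᶜ 7 (foldᶜ 6 (foldᶜ 7 (placeᶜ 0F &ᶜ halts-with-0-onᶜ) (constᶜ 25)) (constᶜ 30))
    (times-5 ∘ᶜ (constᶜ 11 +ᶜ placeᶜ 0F))
  where
  times-5 : Computable {1} (λ xs → lookup xs 0F * 5)
  times-5 = recᶜ zeroᶜ (constᶜ 5 +ᶜ placeᶜ 1F) (λ _ → refl) (λ _ _ → refl)

-- `all^` and `ex^` peel off the innermost quantifier, `fold` the outermost; this moves one
-- application across.
fold-shift : ∀ t n y → fold (pair t y) ⟪ t ,_⟫ n ≡ ⟪ t , fold y ⟪ t ,_⟫ n ⟫
fold-shift t zero    y = pair≡⟪⟫ t y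
fold-shift t (suc n) y = cong ⟪ t ,_⟫ (fold-shift t n y)

code-all^ : ∀ n {k} (φ : Formula (n + k)) → code (all^ n φ) ≡ fold (code φ) ⟪ 6 ,_⟫ n
code-all^ zero    φ = refl
code-all^ (suc n) φ = trans (code-all^ n (all φ)) (fold-shift 6 n (code φ))

code-ex^ : ∀ n {k} (φ : Formula (n + k)) → code (ex^ n φ) ≡ fold (code φ) ⟪ 7 ,_⟫ n
code-ex^ zero    φ = refl
code-ex^ (suc n) φ = trans (code-ex^ n (ex φ)) (fold-shift 7 n (code φ))

code-prefix : ∀ j l m (φ : Formula (m + (l + (j + 0)))) →
  code (ex^ j (all^ l (ex^ m φ))) ≡ fold (fold (fold (code φ) ⟪ 7 ,_⟫ m) ⟪ 6 ,_⟫ l) ⟪ 7 ,_⟫ j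
code-prefix j l m φ =
  trans (code-ex^ j (all^ l (ex^ m φ))) (cong (λ y → fold y ⟪ 7 ,_⟫ j)
    (trans (code-all^ l (ex^ m φ)) (cong (λ y → fold y ⟪ 6 ,_⟫ l) (code-ex^ m φ))))

code-sentence : ∀ N φ → Bounded N φ →
  code (sentence N φ) ≡ prefix-code (suc N * 5) (matrix-code φ)
code-sentence N φ b =
  trans (code-prefix (suc N * 5) 30 25 (formula N φ))
    (cong (prefix-code (suc N * 5)) (formula-code φ b))

numerals-bounded : ∀ {N} k → 4 ≤ N → 2 + k ≤ N → Bounded N (numerals k)
numerals-bounded {N} k 4≤N = go k
  where
  small : ∀ j {j≤4 : T (j ≤ᵇ 4)} → j ≤ N
  small j {j≤4} = ≤-trans (≤ᵇ⇒≤ j 4 j≤4) 4≤N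

  go : ∀ k → 2 + k ≤ N → Bounded N (numerals k)
  go zero    h =
    ((h , small 0) , (h , small 1) , (h , small 2) , (h , h) , (h , h)) ,
    ((h , small 3) , (h , h) , (h , h) , (h , h))
  go (suc k) h =
    (((h , small 0) , (h , small 1) , (h , small 2) , (h , h) , (h , h)) ,
     ((h , small 4) , (h , h) , (h , h′) , (h , h′))) ,
    go k h′
    where
    h′ : 2 + k ≤ N
    h′ = ≤-trans (n≤1+n _) h

-- The greatest label here is that of the call, at block 3 + 7, and the numeral x is block 2 + x;
-- hence the bound `10 + x`.
halts-bounded : ∀ x → Bounded (10 + x) (halts-with-0-on x)
halts-bounded x =
  (((s 0 , s 0) , (s 0 , s 1) , (s 0 , s 2) , (s 0 , s 0) , (s 0 , s 0)) ,
   ((s 0 , s 5) , (s 0 , s 0) , (s 0 , 2+x≤) , (s 0 , s 2)) ,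
   ((s 1 , s 10) , (s 1 , s 0) , (s 1 , s 2) , (s 1 , s 2))) ,
  numerals-bounded x (s 4) 2+x≤
  where
  s : ∀ j {j≤10 : T (j ≤ᵇ 10)} → j ≤ 10 + x
  s j {j≤10} = ≤-trans (≤ᵇ⇒≤ j 10 j≤10) (m≤m+n 10 x)

  2+x≤ : 2 + x ≤ 10 + x
  2+x≤ = +-monoˡ-≤ x (≤ᵇ⇒≤ 2 10 tt)

-- The diagonal argument

S : Sentence → Set
S φ = Prenex-∃*∀∃∀ 30 25 0 φ × TrueOnSomeFiniteGraph φ

module Diagonal (e : Rec 1)
                (e-decides : ComputesCharacteristic e (λ x → ∃[ φ ] S φ × code φ ≡ x))
                (g : Rec 1) (g⇓ : ∀ x → g [ x ∷ [] ]⇓ code-from x) where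

  d : Rec 1
  d = comp e (g ∷ [])

  d⇓ : ∀ x {n} → e [ code-from x ∷ [] ]⇓ n → d [ x ∷ [] ]⇓ n
  d⇓ x e⇓ = comp⇓ (g⇓ x ∷ []) e⇓

  -- The huge code of the program matrix is kept as a variable with an equation instead of being
  -- evaluated.
  module _ (x : ℕ) (x≡ : matrix-code (program-matrix d) ≡ x) where

    -- d at x runs e on `code-from x`, which is the code of σ by `σ-code`. So σ expresses that e
    -- rejects σ.
    σ : Sentence
    σ = sentence (10 + x) (halting-matrix d x)

    matrix-bounded : Bounded (10 + x) (halting-matrix d x)
    matrix-bounded =
      bounded (program-matrix d) (≤-trans (≤-reflexive x≡) (m≤n+m x 10)) , halts-bounded x

    σ-prenex : Prenex-∃*∀∃∀ 30 25 0 σ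
    σ-prenex = (11 + x) * 5 , formula (10 + x) (halting-matrix d x) ,
      formula-qf (10 + x) (halting-matrix d x) , refl

    σ-code : code σ ≡ code-from x
    σ-code = trans (code-sentence (10 + x) (halting-matrix d x) matrix-bounded)
      (cong (λ y → prefix-code ((11 + x) * 5) ⟪ 3 , ⟪ y , matrix-code (halts-with-0-on x) ⟫ ⟫) x≡)

    -- A model would make e accept the code, so d would have value 1 at x, against
    -- `no-model-of-other-value`.
    σ-false : ¬ TrueOnSomeFiniteGraph σ
    σ-false (G , holds) =
      let c , m = sentence-elim G {10 + x} {halting-matrix d x} matrix-bounded holds in
      Reading.no-model-of-other-value G c {d} {x} {0}
        (d⇓ x (proj₁ (e-decides (code-from x)) (σ , (σ-prenex , G , holds) , σ-code))) m

    -- By `σ-false` e must reject the code. This is a computation of d with value 0, which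
    -- `halting-model` turns into a graph.
    σ-true : TrueOnSomeFiniteGraph σ
    σ-true = halting-model d x (d⇓ x (proj₂ (e-decides (code-from x)) code-rejected)) matrix-bounded
      where
      code-rejected : ¬ (∃[ φ ] S φ × code φ ≡ code-from x)
      code-rejected (φ , (_ , holds) , φ-code) =
        -- The decided set consists of codes, so a sentence with this code has first to be
        -- identified with σ.
        σ-false (subst TrueOnSomeFiniteGraph (code-injective φ σ (trans φ-code (sym σ-code))) holds)

theorem5p10 : ∃[ l ] ∃[ m ] ∃[ n ] Undecidable (λ φ → Prenex-∃*∀∃∀ l m n φ × TrueOnSomeFiniteGraph φ)
theorem5p10 = 30 , 25 , 0 , λ (e , e-decides) →
  let open Diagonal e e-decides
             (Computable.term code-fromᶜ) (λ x → Computable.value⇓ code-fromᶜ (x ∷ []))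
  in σ-false _ refl (σ-true _ refl)
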